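{- Let $S\equiv\pm\{3, 4, 5, 6, 7, 9, 15, 16, 17, 18, 19, 21\}\pmod{48}$ and $T\equiv\pm\{1, 3, 6, 9, 11, 13, 15, 16, 18, 20, 21, 23\}\pmod{48}$. Then $p(S,n)=p(T,n-3)$ for all $n\geq 3$.
   Context: For a set $S$ of positive integers and an integer $n\ge 0$, $p(S,n)$ denotes the number of partitions of $n$ into parts belonging to $S$ (so $p(S,0)=1$). The notation $S\equiv\pm\{r_1,\dots,r_k\}\pmod M$ means that $S$ is the set of all positive integers $n$ such that $n\equiv r_i$ or $n\equiv -r_i\pmod M$ for some $i$. -}

module Defs where

open import Data.Nat using (ℕ; zero; suc; _+_; _*_; _∸_; _≤ᵇ_; _≡ᵇ_)
open import Data.Nat.DivMod using (_%_)
open import Data.Bool using (Bool; true; false; _∨_; if_then_else_)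
open import Data.Bool.ListAction using (any)
open import Data.List using (List; []; _∷_; length; map; _++_; concatMap; replicate; upTo)

-- A set S of positive integers, as a Boolean membership predicate on ℕ
-- (only positive arguments are ever queried).
PosSet : Set
PosSet = ℕ → Bool

-- S ≡ ±{r₁,…,rₖ} (mod M) with M = suc m: the positive integers n with
-- n ≡ rᵢ or n ≡ -rᵢ (mod M) for some i.
pmSet : ℕ → List ℕ → PosSet
pmSet m rs zero = false
pmSet m rs (suc k) =
  any (λ r → ((suc k % suc m) ≡ᵇ (r % suc m)) ∨ (((suc k + r) % suc m) ≡ᵇ 0)) rs

-- Explicit enumeration of all partitions of n into parts belonging to S and
-- each at most b; a partition is listed as its non-increasing list of parts.
-- For part size (suc b) ∈ S, choose its multiplicity j (j * (suc b) ≤ n).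
partitionsLE : PosSet → ℕ → ℕ → List (List ℕ)
partitionsLE S zero zero = [] ∷ []
partitionsLE S zero (suc n) = []
partitionsLE S (suc b) n =
  if S (suc b)
  then concatMap
         (λ j → if (j * suc b) ≤ᵇ n
                then map (replicate j (suc b) ++_) (partitionsLE S b (n ∸ j * suc b))
                else [])
         (upTo (suc n))
  else partitionsLE S b n

-- All partitions of n into parts from S (parts never exceed n).
partitions : PosSet → ℕ → List (List ℕ)
partitions S n = partitionsLE S n n

p : PosSet → ℕ → ℕ
p S n = length (partitions S n)

{-# OPTIONS --safe #-}

-- Put D_X = ∏_{x ∈ X} (1 - qˣ).  Since 1 / D_X generates p(X, n), the theorem says
-- 1 / D_S = 1 + q³ / D_T, that is, D_S D_T + q³ D_S = D_T.
-- Let f(a, b) = Σ_{k ∈ ℤ} a^{k(k+1)/2} b^{k(k-1)/2}.  Separating even and odd k gives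
--   f(±q, ±q²)  = f(q⁵, q⁷) ± q f(q¹¹, q),    f(±q, ±q⁵) = f(q⁸, q¹⁶) ± q f(q²⁰, q⁴),
--   f(±q², ±q⁴) = f(q¹⁰, q¹⁴) ± q² f(q²², q²).
-- By the Jacobi triple product, f(±q, ±q²) f(∓q², ∓q⁴) = Y f(±q, ±q⁵) with one and the same
-- product Y for both signs; adding the two identities yields
--   Y f(q⁸, q¹⁶) + q³ f(q²², q²) f(q¹¹, q) = f(q¹⁰, q¹⁴) f(q⁵, q⁷),
-- and rewriting each theta as a product turns this into the claim, up to invertible factors.
-- Everything happens modulo qᴺ, where all series and products involved are finite.

module Submission where

open import Defs
open import Algebra using (CommutativeRing; IsCommutativeRing)
open import Data.Bool using (true; false; if_then_else_; _∨_; T)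
open import Data.Integer as ℤ using (ℤ; +_; 0ℤ; 1ℤ)
import Data.Integer.Properties as ℤ
import Data.Integer.Solver as ℤ
open import Data.List
  using (List; []; _∷_; _++_; length; map; concatMap; replicate; applyUpTo; downFrom; filterᵇ; foldr)
import Data.List.Properties as List
open import Data.List.Relation.Binary.Permutation.Propositional as ↭
  using (_↭_; ↭-sym; ↭-trans; ↭-reflexive)
open import Data.Nat as ℕ using (ℕ; zero; suc; z≤n; s≤s; NonZero; _≤ᵇ_; _≡ᵇ_)
open import Data.Nat.DivMod using (_%_; [m+kn]%n≡m%n)
import Data.Nat.Properties as ℕ
import Data.Nat.Solver as ℕ
open import Data.List.Sort.InsertionSort.Base ℕ.≤-decTotalOrder using (sort)
open import Data.List.Sort.InsertionSort.Properties ℕ.≤-decTotalOrder using (sort-↭)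
open import Data.Product using (Σ; _,_)
open import Data.Sum using (inj₁; inj₂)
open import Function using (_∘_)
open import Level using (0ℓ)
open import Relation.Binary.PropositionalEquality as ≡ using (_≡_)
open import Relation.Nullary using (contradiction)
import Algebra.Properties.CommutativeSemiring.Exp as Exp
import Algebra.Properties.Ring as RingProperties
import Algebra.Solver.Ring.NaturalCoefficients.Default as SemiringSolver
import Relation.Binary.Reasoning.Setoid as SetoidReasoning

-- Theta series and the Jacobi triple product

-- The theta and product identities are proved in an arbitrary commutative ring with `q ^ N ≈ 0#`.
-- Nilpotence kills theta terms far from the centre and makes product factors beyond the first `N`
-- equal to 1, so a product of `N` factors stands for the infinite one and no limit occurs. Division
-- is avoided throughout: the expansion behind the triple product is multiplied through by (Q; Q)_∞,
-- and a quotient B / A enters as some `C` with `A * C ≈ B`. Two cancellations remain. The factor 2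
-- left by adding the two sign choices asks for a `Halvable` ring, which integer coefficients
-- provide. The factor ∏ (1 - q¹²ᵏ)(1 - q²⁴ᵏ), shared by the products of thetas, is a unit because
-- each of its factors is 1 plus a nilpotent element.

n+n≡n*2 : ∀ n → n ℕ.+ n ≡ n ℕ.* 2
n+n≡n*2 n = ≡.trans (≡.cong (n ℕ.+_) (≡.sym (ℕ.+-identityʳ n))) (ℕ.*-comm 2 n)

module ThetaSeries (R : CommutativeRing 0ℓ 0ℓ) where

  open CommutativeRing R
  open Exp commutativeSemiring
  open RingProperties ring
  open SemiringSolver commutativeSemiring using (solve; _:=_; _:+_; _:*_; con)
  open SetoidReasoning setoid

  x≈0⇒x*y≈0 : ∀ {x} y → x ≈ 0# → x * y ≈ 0#
  x≈0⇒x*y≈0 y x≈0 = trans (*-congʳ x≈0) (zeroˡ y)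

  y≈0⇒x*y≈0 : ∀ x {y} → y ≈ 0# → x * y ≈ 0#
  y≈0⇒x*y≈0 x y≈0 = trans (*-congˡ y≈0) (zeroʳ x)

  ^-nilpotent : ∀ {x m n} → x ^ m ≈ 0# → m ℕ.≤ n → x ^ n ≈ 0#
  ^-nilpotent {x} {m} {n} x^m≈0 m≤n = begin
    x ^ n                     ≡⟨ ≡.cong (x ^_) (ℕ.m+[n∸m]≡n m≤n) ⟨
    x ^ (m ℕ.+ (n ℕ.∸ m))     ≈⟨ ^-homo-* x m (n ℕ.∸ m) ⟩
    x ^ m * x ^ (n ℕ.∸ m)     ≈⟨ x≈0⇒x*y≈0 _ x^m≈0 ⟩
    0#                        ∎

  ∑ : (ℕ → Carrier) → ℕ → Carrier
  ∑ f zero    = 0#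
  ∑ f (suc n) = f 0 + ∑ (f ∘ suc) n

  ∑-cong : ∀ {f g} n → (∀ i → f i ≈ g i) → ∑ f n ≈ ∑ g n
  ∑-cong zero    f≈g = refl
  ∑-cong (suc n) f≈g = +-cong (f≈g 0) (∑-cong n (f≈g ∘ suc))

  ∑-zero : ∀ {f} n → (∀ i → f i ≈ 0#) → ∑ f n ≈ 0#
  ∑-zero zero    f≈0 = refl
  ∑-zero (suc n) f≈0 = trans (+-cong (f≈0 0) (∑-zero n (f≈0 ∘ suc))) (+-identityˡ 0#)

  ∑-last : ∀ f n → ∑ f (suc n) ≈ ∑ f n + f n
  ∑-last f zero    = +-comm (f 0) 0#
  ∑-last f (suc n) = trans (+-congˡ (∑-last (f ∘ suc) n)) (sym (+-assoc _ _ _))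

  ∑-+ : ∀ f g n → ∑ (λ i → f i + g i) n ≈ ∑ f n + ∑ g n
  ∑-+ f g zero    = sym (+-identityˡ 0#)
  ∑-+ f g (suc n) = trans (+-congˡ (∑-+ (f ∘ suc) (g ∘ suc) n))
    (solve 4 (λ a b c d → (a :+ b) :+ (c :+ d) := (a :+ c) :+ (b :+ d)) refl _ _ _ _)

  ∑-* : ∀ x f n → ∑ (λ i → x * f i) n ≈ x * ∑ f n
  ∑-* x f zero    = sym (zeroʳ x)
  ∑-* x f (suc n) = trans (+-congˡ (∑-* x (f ∘ suc) n)) (sym (distribˡ _ _ _))

  -- The closed form is A^k Q^{k(k-1)/2}. For Q = AB this is the term of f(A, B) with index k, and
  -- `wt B Q k` is the one with index -k.
  wt : Carrier → Carrier → ℕ → Carrier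
  wt A Q zero    = 1#
  wt A Q (suc k) = A * wt (A * Q) Q k

  wt-cong : ∀ {A A′ Q Q′} k → A ≈ A′ → Q ≈ Q′ → wt A Q k ≈ wt A′ Q′ k
  wt-cong zero    A≈ Q≈ = refl
  wt-cong (suc k) A≈ Q≈ = *-cong A≈ (wt-cong k (*-cong A≈ Q≈) Q≈)

  wt-shift : ∀ A Q k → wt (A * Q) Q k ≈ Q ^ k * wt A Q k
  wt-shift A Q zero    = sym (*-identityˡ 1#)
  wt-shift A Q (suc k) = trans (*-congˡ (wt-shift (A * Q) Q k))
    (solve 4 (λ a q t w → (a :* q) :* (t :* w) := (q :* t) :* (a :* w)) refl _ _ _ _)

  wt-last : ∀ A Q k → wt A Q (suc k) ≈ (A * Q ^ k) * wt A Q k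
  wt-last A Q k = trans (*-congˡ (wt-shift A Q k)) (sym (*-assoc _ _ _))

  wt-factor : ∀ A Q k → wt A Q k ≈ A ^ k * wt 1# Q k
  wt-factor A Q zero    = sym (*-identityˡ 1#)
  wt-factor A Q (suc k) = begin
    wt A Q (suc k)                         ≈⟨ wt-last A Q k ⟩
    (A * Q ^ k) * wt A Q k                 ≈⟨ *-congˡ (wt-factor A Q k) ⟩
    (A * Q ^ k) * (A ^ k * wt 1# Q k)
      ≈⟨ solve 4 (λ a t s w → (a :* t) :* (s :* w) := (a :* s) :* ((con 1 :* t) :* w)) refl _ _ _ _ ⟩
    (A * A ^ k) * ((1# * Q ^ k) * wt 1# Q k) ≈⟨ *-congˡ (wt-last 1# Q k) ⟨
    A ^ suc k * wt 1# Q (suc k)            ∎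

  wt-vanish : ∀ {A} Q {n k} → A ^ n ≈ 0# → n ℕ.≤ k → wt A Q k ≈ 0#
  wt-vanish {A} Q {k = k} A^n≈0 n≤k =
    trans (wt-factor A Q k) (x≈0⇒x*y≈0 _ (^-nilpotent A^n≈0 n≤k))

  -- In standard notation (-A; Q)_n: the factors are 1 + A Qⁱ, so (Q; Q)_n is `poch (- Q) Q n`.
  poch : Carrier → Carrier → ℕ → Carrier
  poch A Q zero    = 1#
  poch A Q (suc n) = (1# + A) * poch (A * Q) Q n

  poch-cong : ∀ {A A′ Q Q′} n → A ≈ A′ → Q ≈ Q′ → poch A Q n ≈ poch A′ Q′ n
  poch-cong zero    A≈ Q≈ = refl
  poch-cong (suc n) A≈ Q≈ = *-cong (+-congˡ A≈) (poch-cong n (*-cong A≈ Q≈) Q≈)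

  poch-last : ∀ A Q n → poch A Q (suc n) ≈ (1# + A * Q ^ n) * poch A Q n
  poch-last A Q zero    = *-congʳ (+-congˡ (sym (*-identityʳ A)))
  poch-last A Q (suc n) = trans (*-congˡ (poch-last (A * Q) Q n))
    (solve 4 (λ a q t p → (con 1 :+ a) :* ((con 1 :+ (a :* q) :* t) :* p)
                        := (con 1 :+ a :* (q :* t)) :* ((con 1 :+ a) :* p)) refl _ _ _ _)

  poch-zero : ∀ {A} Q n → A ≈ 0# → poch A Q n ≈ 1#
  poch-zero Q zero    A≈0 = refl
  poch-zero {A} Q (suc n) A≈0 = begin
    (1# + A) * poch (A * Q) Q n ≈⟨ *-cong (+-congˡ A≈0) (poch-zero Q n (x≈0⇒x*y≈0 Q A≈0)) ⟩
    (1# + 0#) * 1#              ≈⟨ solve 0 ((con 1 :+ con 0) :* con 1 := con 1) refl ⟩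
    1#                          ∎

  poch-stable : ∀ A {Q N} k → Q ^ N ≈ 0# → poch A Q (k ℕ.+ N) ≈ poch A Q N
  poch-stable A zero Q^N≈0 = refl
  poch-stable A {Q} {N} (suc k) Q^N≈0 = begin
    poch A Q (suc (k ℕ.+ N))                       ≈⟨ poch-last A Q (k ℕ.+ N) ⟩
    (1# + A * Q ^ (k ℕ.+ N)) * poch A Q (k ℕ.+ N)
      ≈⟨ *-cong (+-congˡ (y≈0⇒x*y≈0 A (^-nilpotent Q^N≈0 (ℕ.m≤n+m N k)))) (poch-stable A k Q^N≈0) ⟩
    (1# + 0#) * poch A Q N                         ≈⟨ *-congʳ (+-identityʳ 1#) ⟩
    1# * poch A Q N                                ≈⟨ *-identityˡ _ ⟩
    poch A Q N                                     ∎

  -- The bilateral terms w₀ = 1, wₖ = wt A Q k, w₋ₖ = wt B Q k (k > 0) are read downwards from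
  -- index m: θ A B Q m j is wₘ₋ⱼ.  Thus Θ A B Q m below sums w over the indices -m-1, …, m.
  θ : Carrier → Carrier → Carrier → ℕ → ℕ → Carrier
  θ A B Q zero    j       = wt B Q j
  θ A B Q (suc m) zero    = wt A Q (suc m)
  θ A B Q (suc m) (suc j) = θ A B Q m j

  θ-cong : ∀ {A A′ B B′ Q Q′} m j → A ≈ A′ → B ≈ B′ → Q ≈ Q′ → θ A B Q m j ≈ θ A′ B′ Q′ m j
  θ-cong zero    j       A≈ B≈ Q≈ = wt-cong j B≈ Q≈
  θ-cong (suc m) zero    A≈ B≈ Q≈ = wt-cong (suc m) A≈ Q≈
  θ-cong (suc m) (suc j) A≈ B≈ Q≈ = θ-cong m j A≈ B≈ Q≈

  θ-positive : ∀ A B Q k j → θ A B Q (j ℕ.+ k) j ≈ wt A Q k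
  θ-positive A B Q zero    zero    = refl
  θ-positive A B Q (suc k) zero    = refl
  θ-positive A B Q k       (suc j) = θ-positive A B Q k j

  θ-negative : ∀ A B Q k m → θ A B Q m (m ℕ.+ k) ≈ wt B Q k
  θ-negative A B Q k zero    = refl
  θ-negative A B Q k (suc m) = θ-negative A B Q k m

  -- Neighbouring terms satisfy wₖ₊₁ = A Qᵏ wₖ for every integer k, where k < 0 rests on AB = Q. At
  -- k = m - j the possibly negative power is cleared by multiplying with Qʲ.
  θ-step : ∀ {A B Q} m j → A * B ≈ Q → (A * Q ^ m) * θ A B Q m j ≈ Q ^ j * θ A B Q (suc m) j
  θ-step {A} {B} {Q} zero zero AB≈Q =
    solve 1 (λ a → (a :* con 1) :* con 1 := con 1 :* (a :* con 1)) refl _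
  θ-step {A} {B} {Q} zero (suc j) AB≈Q = begin
    (A * 1#) * wt B Q (suc j)          ≈⟨ *-congˡ (wt-last B Q j) ⟩
    (A * 1#) * ((B * Q ^ j) * wt B Q j)
      ≈⟨ solve 4 (λ a b t w → (a :* con 1) :* ((b :* t) :* w) := ((a :* b) :* t) :* w) refl _ _ _ _ ⟩
    ((A * B) * Q ^ j) * wt B Q j       ≈⟨ *-congʳ (*-congʳ AB≈Q) ⟩
    (Q * Q ^ j) * wt B Q j             ∎
  θ-step {A} {B} {Q} (suc m) zero AB≈Q = trans (sym (wt-last A Q (suc m))) (sym (*-identityˡ _))
  θ-step {A} {B} {Q} (suc m) (suc j) AB≈Q = begin
    (A * (Q * Q ^ m)) * θ A B Q m j
      ≈⟨ solve 4 (λ a q t w → (a :* (q :* t)) :* w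
          := q :* ((a :* t) :* w)) refl _ _ _ _ ⟩
    Q * ((A * Q ^ m) * θ A B Q m j)    ≈⟨ *-congˡ (θ-step m j AB≈Q) ⟩
    Q * (Q ^ j * θ A B Q (suc m) j)    ≈⟨ *-assoc _ _ _ ⟨
    Q ^ suc j * θ A B Q (suc m) j      ∎

  Θ : Carrier → Carrier → Carrier → ℕ → Carrier
  Θ A B Q m = ∑ (θ A B Q m) (suc m ℕ.* 2)

  ∑-pairs : ∀ f n → ∑ f (n ℕ.* 2) ≈ ∑ (λ i → f (suc (i ℕ.* 2))) n + ∑ (λ i → f (i ℕ.* 2)) n
  ∑-pairs f zero    = sym (+-identityˡ 0#)
  ∑-pairs f (suc n) = trans (+-congˡ (+-congˡ (∑-pairs (f ∘ suc ∘ suc) n)))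
    (solve 4 (λ a b c d → a :+ (b :+ (c :+ d)) := (b :+ c) :+ (a :+ d)) refl _ _ _ _)

  wt-even : ∀ A Q k → wt A Q (k ℕ.* 2) ≈ wt ((A * A) * Q) (Q ^ 4) k
  wt-even A Q zero    = refl
  wt-even A Q (suc k) = begin
    A * ((A * Q) * wt ((A * Q) * Q) Q (k ℕ.* 2))
      ≈⟨ solve 3 (λ a q w → a :* ((a :* q) :* w) := ((a :* a) :* q) :* w) refl _ _ _ ⟩
    ((A * A) * Q) * wt ((A * Q) * Q) Q (k ℕ.* 2)
      ≈⟨ *-congˡ (wt-even ((A * Q) * Q) Q k) ⟩
    ((A * A) * Q) * wt ((((A * Q) * Q) * ((A * Q) * Q)) * Q) (Q ^ 4) k
      ≈⟨ *-congˡ (wt-cong k (solve 2 (λ a q → (((a :* q) :* q) :* ((a :* q) :* q)) :* q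
           := ((a :* a) :* q) :* (q :* (q :* (q :* (q :* con 1))))) refl _ _) refl) ⟩
    ((A * A) * Q) * wt (((A * A) * Q) * Q ^ 4) (Q ^ 4) k ∎

  wt-odd : ∀ A Q k → wt A Q (suc (k ℕ.* 2)) ≈ A * wt ((A * A) * Q ^ 3) (Q ^ 4) k
  wt-odd A Q k = *-congˡ (trans (wt-even (A * Q) Q k)
    (wt-cong k (solve 2 (λ a q → ((a :* q) :* (a :* q)) :* q
      := (a :* a) :* (q :* (q :* (q :* con 1)))) refl _ _) refl))

  Θ-cong : ∀ {A A′ B B′ Q Q′} m → A ≈ A′ → B ≈ B′ → Q ≈ Q′ → Θ A B Q m ≈ Θ A′ B′ Q′ m
  Θ-cong m A≈ B≈ Q≈ = ∑-cong (suc m ℕ.* 2) (λ j → θ-cong m j A≈ B≈ Q≈)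

  -- `C` stands for B / A. Once A is taken out of the odd terms w₂ᵢ₊₁, the terms at i = 1 and i = -1
  -- are A² Q³ and `C`, whose product is Q⁴, so they again form a theta series.
  module Dissection {A B C Q : Carrier} (AC≈B : A * C ≈ B) (AB≈Q : A * B ≈ Q) where

    θ-even : ∀ m i → θ A B Q (suc (m ℕ.* 2)) (suc (i ℕ.* 2))
                   ≈ θ ((A * A) * Q) ((B * B) * Q) (Q ^ 4) m i
    θ-even zero    i       = wt-even B Q i
    θ-even (suc m) zero    = wt-even A Q (suc m)
    θ-even (suc m) (suc i) = θ-even m i

    wt-odd-negative : ∀ k → wt B Q (suc (k ℕ.* 2)) ≈ A * wt C (Q ^ 4) (suc k)
    wt-odd-negative k = begin
      wt B Q (suc (k ℕ.* 2))                      ≈⟨ wt-odd B Q k ⟩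
      B * wt ((B * B) * Q ^ 3) (Q ^ 4) k          ≈⟨ *-cong (sym AC≈B) (wt-cong k base refl) ⟩
      (A * C) * wt (C * Q ^ 4) (Q ^ 4) k          ≈⟨ *-assoc _ _ _ ⟩
      A * wt C (Q ^ 4) (suc k)                    ∎
      where
      base : (B * B) * Q ^ 3 ≈ C * Q ^ 4
      base = begin
        (B * B) * Q ^ 3            ≈⟨ *-congʳ (*-congʳ AC≈B) ⟨
        ((A * C) * B) * Q ^ 3
          ≈⟨ solve 4 (λ a b c q → ((a :* c) :* b) :* q
              := c :* ((a :* b) :* q)) refl _ _ _ _ ⟩
        C * ((A * B) * Q ^ 3)      ≈⟨ *-congˡ (*-congʳ AB≈Q) ⟩
        C * Q ^ 4                  ∎

    θ-odd : ∀ m i → θ A B Q (suc (m ℕ.* 2)) (i ℕ.* 2)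
                  ≈ A * θ ((A * A) * Q ^ 3) C (Q ^ 4) m i
    θ-odd zero    zero    = wt-odd A Q 0
    θ-odd (suc m) zero    = wt-odd A Q (suc m)
    θ-odd zero    (suc i) = wt-odd-negative i
    θ-odd (suc m) (suc i) = θ-odd m i

    -- Exact for finite sums thanks to the lopsided window: both 2i and 2i + 1 run through -2m-2,
    -- ..., 2m+1 precisely when i runs through -m-1, ..., m.
    dissection : ∀ m → Θ A B Q (suc (m ℕ.* 2))
      ≈ Θ ((A * A) * Q) ((B * B) * Q) (Q ^ 4) m + A * Θ ((A * A) * Q ^ 3) C (Q ^ 4) m
    dissection m = trans (∑-pairs (θ A B Q (suc (m ℕ.* 2))) (suc m ℕ.* 2))
      (+-cong (∑-cong (suc m ℕ.* 2) (θ-even m))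
              (trans (∑-cong (suc m ℕ.* 2) (θ-odd m))
                     (∑-* A (θ ((A * A) * Q ^ 3) C (Q ^ 4) m) (suc m ℕ.* 2))))

  module JacobiTripleProduct {A B Q : Carrier} {N : ℕ}
    (AB≈Q : A * B ≈ Q) (A^N≈0 : A ^ N ≈ 0#) (B^N≈0 : B ^ N ≈ 0#) where

    Q^N≈0 : Q ^ N ≈ 0#
    Q^N≈0 = begin
      Q ^ N          ≈⟨ ^-congˡ N AB≈Q ⟨
      (A * B) ^ N    ≈⟨ ^-distrib-* A B N ⟩
      A ^ N * B ^ N  ≈⟨ x≈0⇒x*y≈0 _ A^N≈0 ⟩
      0#             ∎

    -- (Q^{j+1}; Q)_∞
    tail : ℕ → Carrier
    tail j = poch (- (Q * Q ^ j)) Q N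

    tail-step : ∀ j → tail j + (Q * Q ^ j) * tail (suc j) ≈ tail (suc j)
    tail-step j = begin
      tail j + x * t                     ≈⟨ +-congʳ tail-suc ⟩
      (1# + - x) * t + x * t
        ≈⟨ solve 3 (λ y z t → (con 1 :+ y) :* t :+ z :* t
            := t :+ (y :+ z) :* t) refl _ _ _ ⟩
      t + (- x + x) * t                  ≈⟨ +-congˡ (x≈0⇒x*y≈0 t (-‿inverseˡ x)) ⟩
      t + 0#                             ≈⟨ +-identityʳ t ⟩
      t                                  ∎
      where
      x = Q * Q ^ j
      t = tail (suc j)
      tail-suc : tail j ≈ (1# + - x) * t
      tail-suc = begin
        tail j                             ≈⟨ poch-stable (- x) {Q} {N} 1 Q^N≈0 ⟨
        (1# + - x) * poch (- x * Q) Q N    ≈⟨ *-congˡ (poch-cong N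
          (trans (sym (-‿distribˡ-* x Q)) (-‿cong (*-comm x Q))) refl) ⟩
        (1# + - x) * t                     ∎

    tail-vanish : ∀ {j} → N ℕ.≤ j → tail j ≈ 1#
    tail-vanish N≤j = poch-zero Q N
      (trans (-‿cong (y≈0⇒x*y≈0 Q (^-nilpotent Q^N≈0 N≤j))) -0#≈0#)

    -- Euler's series Σ bʲ Q^{j(j-1)/2} / (Q; Q)_j multiplied by (Q; Q)_∞, which turns the
    -- denominators into `tail j`.
    euler : Carrier → ℕ → Carrier
    euler b L = ∑ (λ j → tail j * wt b Q j) L

    -- In the product (1 + b) E(bQ), the j-th term of b E(bQ) joins the (j+1)-st term of E(bQ), and
    -- `tail-step` merges them. Iterating moves the argument to b Q^N, which is zero.
    euler-step : ∀ {b} {L} → b ^ N ≈ 0# → N ℕ.≤ L →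
      euler b (suc L) ≈ (1# + b) * euler (b * Q) (suc L)
    euler-step {b} {L} b^N≈0 N≤L = sym (begin
      (1# + b) * euler (b * Q) (suc L)
        ≈⟨ trans (distribʳ _ _ _) (+-congʳ (*-identityˡ _)) ⟩
      euler (b * Q) (suc L) + b * euler (b * Q) (suc L)
        ≈⟨ +-congˡ (trans (sym (∑-* b (λ j → tail j * wt (b * Q) Q j) (suc L))) (∑-last (λ j → b * (tail j * wt (b * Q) Q j)) L)) ⟩
      (tail 0 * 1# + ∑ (λ j → tail (suc j) * wt (b * Q) Q (suc j)) L)
        + (∑ (λ j → b * (tail j * wt (b * Q) Q j)) L + b * (tail L * wt (b * Q) Q L))
        ≈⟨ +-congˡ (trans (+-congˡ last≈0) (+-identityʳ _)) ⟩
      (tail 0 * 1# + ∑ (λ j → tail (suc j) * wt (b * Q) Q (suc j)) L)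
        + ∑ (λ j → b * (tail j * wt (b * Q) Q j)) L
        ≈⟨ trans (+-assoc _ _ _) (+-congˡ (sym (∑-+ _ _ L))) ⟩
      tail 0 * 1# + ∑ (λ j → tail (suc j) * wt (b * Q) Q (suc j) + b * (tail j * wt (b * Q) Q j)) L
        ≈⟨ +-congˡ (∑-cong L term) ⟩
      euler b (suc L) ∎)
      where
      last≈0 : b * (tail L * wt (b * Q) Q L) ≈ 0#
      last≈0 = begin
        b * (tail L * wt (b * Q) Q L)
          ≈⟨ solve 3 (λ b t w → b :* (t :* w) := t :* (b :* w)) refl _ _ _ ⟩
        tail L * wt b Q (suc L)
          ≈⟨ y≈0⇒x*y≈0 _ (wt-vanish Q b^N≈0 (ℕ.m≤n⇒m≤1+n N≤L)) ⟩
        0# ∎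
      term : ∀ j → tail (suc j) * wt (b * Q) Q (suc j) + b * (tail j * wt (b * Q) Q j)
                 ≈ tail (suc j) * wt b Q (suc j)
      term j = begin
        tail (suc j) * wt (b * Q) Q (suc j) + b * (tail j * wt (b * Q) Q j)
          ≈⟨ +-congʳ (*-congˡ (wt-shift b Q (suc j))) ⟩
        tail (suc j) * ((Q * Q ^ j) * wt b Q (suc j)) + b * (tail j * wt (b * Q) Q j)
          ≈⟨ solve 5 (λ s x b t w → s :* (x :* (b :* w)) :+ b :* (t :* w)
                := (t :+ x :* s) :* (b :* w)) refl _ _ _ _ _ ⟩
        (tail j + (Q * Q ^ j) * tail (suc j)) * wt b Q (suc j)
          ≈⟨ *-congʳ (tail-step j) ⟩
        tail (suc j) * wt b Q (suc j) ∎

    euler-product : ∀ {b L} n → b ^ N ≈ 0# → N ℕ.≤ L →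
      euler b (suc L) ≈ poch b Q n * euler (b * Q ^ n) (suc L)
    euler-product {b} {L} zero b^N≈0 N≤L = trans
      (∑-cong (suc L) (λ j → *-congˡ {tail j} (wt-cong {Q = Q} j (sym (*-identityʳ b)) refl)))
      (sym (*-identityˡ _))
    euler-product {b} {L} (suc n) b^N≈0 N≤L = begin
      euler b (suc L)                      ≈⟨ euler-step b^N≈0 N≤L ⟩
      (1# + b) * euler (b * Q) (suc L)     ≈⟨ *-congˡ (euler-product n bQ^N≈0 N≤L) ⟩
      (1# + b) * (poch (b * Q) Q n * euler ((b * Q) * Q ^ n) (suc L))
        ≈⟨ *-assoc _ _ _ ⟨
      poch b Q (suc n) * euler ((b * Q) * Q ^ n) (suc L)
        ≈⟨ *-congˡ (∑-cong (suc L) (λ j → *-congˡ {tail j} (wt-cong {Q = Q} j (*-assoc b Q (Q ^ n)) refl))) ⟩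
      poch b Q (suc n) * euler (b * Q ^ suc n) (suc L) ∎
      where
      bQ^N≈0 : (b * Q) ^ N ≈ 0#
      bQ^N≈0 = trans (^-distrib-* b Q N) (x≈0⇒x*y≈0 _ b^N≈0)

    euler-zero : ∀ {b} L → b ≈ 0# → euler b (suc L) ≈ tail 0
    euler-zero {b} L b≈0 = begin
      tail 0 * 1# + ∑ (λ j → tail (suc j) * wt b Q (suc j)) L
        ≈⟨ +-cong (*-identityʳ _) (∑-zero L (λ j → y≈0⇒x*y≈0 _ (x≈0⇒x*y≈0 _ b≈0))) ⟩
      tail 0 + 0#  ≈⟨ +-identityʳ _ ⟩
      tail 0       ∎

    -- Raising m multiplies V by 1 + A Q^m, by tail-step.  At m = 0 the sum is Euler's expansion
    -- of (Q; Q)_∞ (-B; Q)_∞, and for large m every nonzero term has tail j = 1.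
    V : ℕ → ℕ → Carrier
    V m L = ∑ (λ j → tail j * θ A B Q m j) L

    -- By `θ-step`, multiplication by A Q^m trades wₘ₋ⱼ for Qʲ wₘ₊₁₋ⱼ. After a shift by one place
    -- the two coefficients of wₘ₋ⱼ are those added in `tail-step`. The term dropped at the end has
    -- index m - L ≤ -N, hence vanishes.
    V-step : ∀ m {L} → m ℕ.+ N ℕ.≤ L → V (suc m) (suc L) ≈ (1# + A * Q ^ m) * V m (suc L)
    V-step m {L} m+N≤L = sym (begin
      (1# + A * Q ^ m) * V m (suc L)
        ≈⟨ trans (distribʳ _ _ _) (+-congʳ (*-identityˡ _)) ⟩
      V m (suc L) + (A * Q ^ m) * V m (suc L)
        ≈⟨ +-cong (trans (∑-last (λ j → tail j * θ A B Q m j) L) (trans (+-congˡ last≈0) (+-identityʳ _)))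
                  (trans (sym (∑-* _ (λ j → tail j * θ A B Q m j) (suc L))) (∑-cong (suc L) shifted)) ⟩
      V m L + (tail 0 * (1# * w 0) + ∑ (λ j → tail (suc j) * ((Q * Q ^ j) * θ A B Q m j)) L)
        ≈⟨ solve 3 (λ a b c → a :+ (b :+ c) := b :+ (a :+ c)) refl _ _ _ ⟩
      tail 0 * (1# * w 0) + (V m L + ∑ (λ j → tail (suc j) * ((Q * Q ^ j) * θ A B Q m j)) L)
        ≈⟨ +-cong (*-congˡ (*-identityˡ _)) (sym (∑-+ _ _ L)) ⟩
      tail 0 * w 0 + ∑ (λ j → tail j * θ A B Q m j + tail (suc j) * ((Q * Q ^ j) * θ A B Q m j)) L
        ≈⟨ +-congˡ (∑-cong L term) ⟩
      V (suc m) (suc L) ∎)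
      where
      w : ℕ → Carrier
      w = θ A B Q (suc m)
      last≈0 : tail L * θ A B Q m L ≈ 0#
      last≈0 = y≈0⇒x*y≈0 _ (begin
        θ A B Q m L                      ≡⟨ ≡.cong (θ A B Q m) (ℕ.m+[n∸m]≡n (ℕ.m+n≤o⇒m≤o m m+N≤L)) ⟨
        θ A B Q m (m ℕ.+ (L ℕ.∸ m))      ≈⟨ θ-negative A B Q (L ℕ.∸ m) m ⟩
        wt B Q (L ℕ.∸ m)                 ≈⟨ wt-vanish Q B^N≈0 (ℕ.m+n≤o⇒m≤o∸n N (≡.subst (ℕ._≤ L) (ℕ.+-comm m N) m+N≤L)) ⟩
        0#                               ∎)
      shifted : ∀ j → (A * Q ^ m) * (tail j * θ A B Q m j) ≈ tail j * (Q ^ j * w j)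
      shifted j = trans (solve 3 (λ x t y → x :* (t :* y) := t :* (x :* y)) refl _ _ _)
                        (*-congˡ (θ-step m j AB≈Q))
      term : ∀ j → tail j * θ A B Q m j + tail (suc j) * ((Q * Q ^ j) * θ A B Q m j)
                 ≈ tail (suc j) * θ A B Q m j
      term j = trans (solve 4 (λ t s x y → t :* y :+ s :* (x :* y) := (t :+ x :* s) :* y) refl _ _ _ _)
                     (*-congʳ (tail-step j))

    V-product : ∀ m {L} → m ℕ.+ N ℕ.≤ L → V m (suc L) ≈ poch A Q m * V 0 (suc L)
    V-product zero    m+N≤L = sym (*-identityˡ _)
    V-product (suc m) {L} m+N≤L = begin
      V (suc m) (suc L)                                  ≈⟨ V-step m (ℕ.<⇒≤ m+N≤L) ⟩
      (1# + A * Q ^ m) * V m (suc L)                     ≈⟨ *-congˡ (V-product m (ℕ.<⇒≤ m+N≤L)) ⟩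
      (1# + A * Q ^ m) * (poch A Q m * V 0 (suc L))      ≈⟨ *-assoc _ _ _ ⟨
      ((1# + A * Q ^ m) * poch A Q m) * V 0 (suc L)      ≈⟨ *-congʳ (poch-last A Q m) ⟨
      poch A Q (suc m) * V 0 (suc L)                     ∎

    jacobi : ∀ m → N ℕ.+ N ℕ.≤ m →
      Θ A B Q m ≈ poch (- Q) Q N * (poch A Q N * poch B Q N)
    jacobi m 2N≤m = begin
      Θ A B Q m                                   ≈⟨ ∑-cong (suc L) drop-tail ⟩
      V m (suc L)                                 ≈⟨ V-product m m+N≤L ⟩
      poch A Q m * V 0 (suc L)                    ≈⟨ *-cong poch-A V₀ ⟩
      poch A Q N * (poch B Q N * poch (- Q) Q N)
        ≈⟨ solve 3 (λ a b c → a :* (b :* c) := c :* (a :* b)) refl _ _ _ ⟩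
      poch (- Q) Q N * (poch A Q N * poch B Q N)  ∎
      where
      L = suc (m ℕ.* 2)
      N≤m : N ℕ.≤ m
      N≤m = ℕ.m+n≤o⇒m≤o N 2N≤m
      m+N≤L : m ℕ.+ N ℕ.≤ L
      m+N≤L = ℕ.m≤n⇒m≤1+n (≡.subst (m ℕ.+ N ℕ.≤_) (n+n≡n*2 m) (ℕ.+-monoʳ-≤ m N≤m))
      poch-A : poch A Q m ≈ poch A Q N
      poch-A = trans (reflexive (≡.cong (poch A Q) (≡.sym (ℕ.m∸n+n≡m N≤m)))) (poch-stable A (m ℕ.∸ N) Q^N≈0)
      V₀ : V 0 (suc L) ≈ poch B Q N * poch (- Q) Q N
      V₀ = begin
        euler B (suc L)                         ≈⟨ euler-product N B^N≈0 (ℕ.m+n≤o⇒n≤o m m+N≤L) ⟩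
        poch B Q N * euler (B * Q ^ N) (suc L)  ≈⟨ *-congˡ (euler-zero L (y≈0⇒x*y≈0 B Q^N≈0)) ⟩
        poch B Q N * tail 0                     ≈⟨ *-congˡ (poch-cong N (-‿cong (*-identityʳ Q)) refl) ⟩
        poch B Q N * poch (- Q) Q N             ∎
      drop-tail : ∀ j → θ A B Q m j ≈ tail j * θ A B Q m j
      -- Either j ≥ N and `tail j` is 1, or j ≤ N and the index m - j is at least N, so the term is
      -- zero on both sides. This is where m ≥ 2N enters.
      drop-tail j with ℕ.≤-total N j
      ... | inj₁ N≤j = sym (trans (*-congʳ (tail-vanish N≤j)) (*-identityˡ _))
      ... | inj₂ j≤N = trans θ≈0 (sym (y≈0⇒x*y≈0 _ θ≈0))
        where
        N≤m∸j : N ℕ.≤ m ℕ.∸ j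
        N≤m∸j = ℕ.m+n≤o⇒m≤o∸n N (ℕ.≤-trans (ℕ.+-monoʳ-≤ N j≤N) 2N≤m)
        θ≈0 : θ A B Q m j ≈ 0#
        θ≈0 = begin
          θ A B Q m j                   ≡⟨ ≡.cong (λ i → θ A B Q i j) (ℕ.m+[n∸m]≡n (ℕ.≤-trans j≤N N≤m)) ⟨
          θ A B Q (j ℕ.+ (m ℕ.∸ j)) j   ≈⟨ θ-positive A B Q (m ℕ.∸ j) j ⟩
          wt A Q (m ℕ.∸ j)              ≈⟨ wt-vanish Q A^N≈0 N≤m∸j ⟩
          0#                            ∎

-- Thetas and products in powers of q, modulo q ^ N

Nilpotent : (R : CommutativeRing 0ℓ 0ℓ) → CommutativeRing.Carrier R → ℕ → Set
Nilpotent R q N = q ^ N ≈ 0#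
  where
  open CommutativeRing R
  open Exp commutativeSemiring

Halvable : CommutativeRing 0ℓ 0ℓ → Set
Halvable R = ∀ {x y} → x + x ≈ y + y → x ≈ y
  where open CommutativeRing R

module MonomialTheta (R : CommutativeRing 0ℓ 0ℓ)
  (q : CommutativeRing.Carrier R) (N : ℕ) (q^N≈0 : Nilpotent R q N) where

  open CommutativeRing R
  open Exp commutativeSemiring
  open ThetaSeries R
  open RingProperties ring
  open SemiringSolver commutativeSemiring using (solve; _:=_; _:+_; _:*_; con)
  open SetoidReasoning setoid
  open ℕ.+-*-Solver using ()
        renaming (solve to solveℕ; _:=_ to _:≡_; _:+_ to _⊕_; _:*_ to _⊗_; con to nat)

  -- The truncated f(s qᵃ, s qᵇ) for a sign s: the base q^{a+b} is the product of the two arguments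
  -- when s² = 1.
  theta : Carrier → ℕ → ℕ → ℕ → Carrier
  theta s a b m = Θ (s * q ^ a) (s * q ^ b) (q ^ (a ℕ.+ b)) m

  G : Carrier → ℕ → ℕ → Carrier
  G s a c = poch (s * q ^ a) (q ^ c) N

  pos neg : ℕ → ℕ → Carrier
  pos = G 1#
  neg = G (- 1#)

  q^-cong : ∀ {a b} → a ≡ b → q ^ a ≈ q ^ b
  q^-cong ≡.refl = refl

  q^a^N≈0 : ∀ a .{{_ : NonZero a}} → (q ^ a) ^ N ≈ 0#
  q^a^N≈0 a = trans (^-assocʳ q a N) (^-nilpotent q^N≈0 (ℕ.m≤n*m N a))

  monomial-nilpotent : ∀ s a .{{_ : NonZero a}} → (s * q ^ a) ^ N ≈ 0#
  monomial-nilpotent s a = trans (^-distrib-* s (q ^ a) N) (y≈0⇒x*y≈0 _ (q^a^N≈0 a))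

  monomial-* : ∀ s t a b → (s * q ^ a) * (t * q ^ b) ≈ (s * t) * q ^ (a ℕ.+ b)
  monomial-* s t a b = begin
    (s * q ^ a) * (t * q ^ b)
      ≈⟨ solve 4 (λ s t x y → (s :* x) :* (t :* y) := (s :* t) :* (x :* y)) refl _ _ _ _ ⟩
    (s * t) * (q ^ a * q ^ b)    ≈⟨ *-congˡ (^-homo-* q a b) ⟨
    (s * t) * q ^ (a ℕ.+ b)      ∎

  monomial-square : ∀ {s} a b → s * s ≈ 1# → (s * q ^ a) * (s * q ^ b) ≈ q ^ (a ℕ.+ b)
  monomial-square a b s²≈1 = trans (monomial-* _ _ a b) (trans (*-congʳ s²≈1) (*-identityˡ _))

  theta-product : ∀ {s} a b .{{_ : NonZero a}} .{{_ : NonZero b}} {m} → s * s ≈ 1# → N ℕ.+ N ℕ.≤ m →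
    theta s a b m ≈ neg (a ℕ.+ b) (a ℕ.+ b) * (G s a (a ℕ.+ b) * G s b (a ℕ.+ b))
  theta-product {s} a b {m} s²≈1 2N≤m = trans
    (JacobiTripleProduct.jacobi {N = N} (monomial-square a b s²≈1)
      (monomial-nilpotent s a) (monomial-nilpotent s b) m 2N≤m)
    (*-congʳ (poch-cong N (sym (-1*x≈-x _)) refl))

  -- Writing b = a + d makes B / A the monomial q^d. The exponents are those of A² Q, B² Q, A² Q³
  -- and B / A; since s² = 1, the sign survives only in front of the odd part.
  theta-dissection : ∀ {s} a d m → s * s ≈ 1# →
    theta s a (a ℕ.+ d) (suc (m ℕ.* 2))
      ≈ theta 1# (4 ℕ.* a ℕ.+ d) (4 ℕ.* a ℕ.+ 3 ℕ.* d) m + (s * q ^ a) * theta 1# (8 ℕ.* a ℕ.+ 3 ℕ.* d) d m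
  theta-dissection {s} a d m s²≈1 = trans
    (Dissection.dissection AC≈B (monomial-square a (a ℕ.+ d) s²≈1) m)
    (+-cong
      (Θ-cong m A²Q B²Q (Q⁴ (solveℕ 2 (λ a d → (a ⊕ (a ⊕ d)) ⊗ nat 4
            :≡ (nat 4 ⊗ a ⊕ d) ⊕ (nat 4 ⊗ a ⊕ nat 3 ⊗ d)) ≡.refl a d)))
      (*-congˡ (Θ-cong m A²Q³ refl (Q⁴ (solveℕ 2 (λ a d → (a ⊕ (a ⊕ d)) ⊗ nat 4
            :≡ (nat 8 ⊗ a ⊕ nat 3 ⊗ d) ⊕ d) ≡.refl a d)))))
    where
    A = s * q ^ a
    B = s * q ^ (a ℕ.+ d)
    c = a ℕ.+ (a ℕ.+ d)
    AC≈B : A * (1# * q ^ d) ≈ B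
    AC≈B = trans (monomial-* s 1# a d) (*-congʳ (*-identityʳ s))
    Q⁴ : ∀ {e} → c ℕ.* 4 ≡ e → (q ^ c) ^ 4 ≈ q ^ e
    Q⁴ eq = trans (^-assocʳ q c 4) (q^-cong eq)
    times : ∀ {e} b f → (b ℕ.+ b) ℕ.+ f ≡ e → ((s * q ^ b) * (s * q ^ b)) * q ^ f ≈ 1# * q ^ e
    times {e} b f eq = begin
      ((s * q ^ b) * (s * q ^ b)) * q ^ f  ≈⟨ *-congʳ (monomial-square b b s²≈1) ⟩
      q ^ (b ℕ.+ b) * q ^ f                ≈⟨ ^-homo-* q (b ℕ.+ b) f ⟨
      q ^ ((b ℕ.+ b) ℕ.+ f)                ≈⟨ q^-cong eq ⟩
      q ^ e                                ≈⟨ *-identityˡ _ ⟨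
      1# * q ^ e                           ∎
    A²Q : (A * A) * q ^ c ≈ 1# * q ^ (4 ℕ.* a ℕ.+ d)
    A²Q = times a c (solveℕ 2 (λ a d → (a ⊕ a) ⊕ (a ⊕ (a ⊕ d)) :≡ nat 4 ⊗ a ⊕ d) ≡.refl a d)
    B²Q : (B * B) * q ^ c ≈ 1# * q ^ (4 ℕ.* a ℕ.+ 3 ℕ.* d)
    B²Q = times (a ℕ.+ d) c
      (solveℕ 2 (λ a d → ((a ⊕ d) ⊕ (a ⊕ d)) ⊕ (a ⊕ (a ⊕ d)) :≡ nat 4 ⊗ a ⊕ nat 3 ⊗ d) ≡.refl a d)
    A²Q³ : (A * A) * (q ^ c) ^ 3 ≈ 1# * q ^ (8 ℕ.* a ℕ.+ 3 ℕ.* d)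
    A²Q³ = trans (*-congˡ (^-assocʳ q c 3)) (times a (c ℕ.* 3)
      (solveℕ 2 (λ a d → (a ⊕ a) ⊕ (a ⊕ (a ⊕ d)) ⊗ nat 3 :≡ nat 8 ⊗ a ⊕ nat 3 ⊗ d) ≡.refl a d))

  poch-split₂ : ∀ A Q n → poch A Q (n ℕ.* 2) ≈ poch A (Q * Q) n * poch (A * Q) (Q * Q) n
  poch-split₂ A Q zero    = sym (*-identityˡ 1#)
  poch-split₂ A Q (suc n) = begin
    (1# + A) * ((1# + A * Q) * poch ((A * Q) * Q) Q (n ℕ.* 2))
      ≈⟨ *-congˡ (*-congˡ (trans (poch-cong (n ℕ.* 2) (*-assoc A Q Q) refl) (poch-split₂ (A * (Q * Q)) Q n))) ⟩
    (1# + A) * ((1# + A * Q) * (poch (A * (Q * Q)) (Q * Q) n * poch ((A * (Q * Q)) * Q) (Q * Q) n))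
      ≈⟨ *-congˡ (*-congˡ (*-congˡ (poch-cong n (solve 2 (λ a q → (a :* (q :* q)) :* q
            := (a :* q) :* (q :* q)) refl _ _) refl))) ⟩
    (1# + A) * ((1# + A * Q) * (poch (A * (Q * Q)) (Q * Q) n * poch ((A * Q) * (Q * Q)) (Q * Q) n))
      ≈⟨ solve 4 (λ x y u v → x :* (y :* (u :* v)) := (x :* u) :* (y :* v)) refl _ _ _ _ ⟩
    poch A (Q * Q) (suc n) * poch (A * Q) (Q * Q) (suc n) ∎

  poch-square : ∀ A Q n → poch A Q n * poch (- A) Q n ≈ poch (- (A * A)) (Q * Q) n
  poch-square A Q zero    = *-identityˡ 1#
  poch-square A Q (suc n) = begin
    ((1# + A) * poch (A * Q) Q n) * ((1# + - A) * poch (- A * Q) Q n)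
      ≈⟨ solve 4 (λ x y u v → (x :* u) :* (y :* v) := (x :* y) :* (u :* v)) refl _ _ _ _ ⟩
    ((1# + A) * (1# + - A)) * (poch (A * Q) Q n * poch (- A * Q) Q n)
      ≈⟨ *-cong difference (*-congˡ (poch-cong n (sym (-‿distribˡ-* A Q)) refl)) ⟩
    (1# + - (A * A)) * (poch (A * Q) Q n * poch (- (A * Q)) Q n)
      ≈⟨ *-congˡ (poch-square (A * Q) Q n) ⟩
    (1# + - (A * A)) * poch (- ((A * Q) * (A * Q))) (Q * Q) n
      ≈⟨ *-congˡ (poch-cong n (trans (-‿cong (solve 2 (λ a q → (a :* q) :* (a :* q)
            := (a :* a) :* (q :* q)) refl _ _))
                                     (-‿distribˡ-* _ _)) refl) ⟩
    poch (- (A * A)) (Q * Q) (suc n) ∎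
    where
    difference : (1# + A) * (1# + - A) ≈ 1# + - (A * A)
    difference = begin
      (1# + A) * (1# + - A)
        ≈⟨ solve 2 (λ a b → (con 1 :+ a) :* (con 1 :+ b)
            := (con 1 :+ a :* b) :+ (a :+ b)) refl _ _ ⟩
      (1# + A * - A) + (A + - A)     ≈⟨ +-cong (+-congˡ (sym (-‿distribʳ-* A A))) (-‿inverseʳ A) ⟩
      (1# + - (A * A)) + 0#          ≈⟨ +-identityʳ _ ⟩
      1# + - (A * A)                 ∎

  G-length : ∀ s a c .{{_ : NonZero c}} {n} → N ℕ.≤ n → poch (s * q ^ a) (q ^ c) n ≈ G s a c
  G-length s a c {n} N≤n = trans
    (reflexive (≡.cong (poch (s * q ^ a) (q ^ c)) (≡.sym (ℕ.m∸n+n≡m N≤n))))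
    (poch-stable (s * q ^ a) {q ^ c} {N} (n ℕ.∸ N) (q^a^N≈0 c))

  monomial-shift : ∀ s a c → (s * q ^ a) * q ^ c ≈ s * q ^ (a ℕ.+ c)
  monomial-shift s a c = trans (*-assoc _ _ _) (*-congˡ (sym (^-homo-* q a c)))

  split₂ : ∀ s a c .{{_ : NonZero c}} → G s a c ≈ G s a (c ℕ.+ c) * G s (a ℕ.+ c) (c ℕ.+ c)
  split₂ s a c = begin
    -- The two halves need `N` factors each, so the left side is lengthened to 2N factors; the added
    -- ones are 1.
    G s a c                                 ≈⟨ G-length s a c (ℕ.m≤m*n N 2) ⟨
    poch (s * q ^ a) (q ^ c) (N ℕ.* 2)      ≈⟨ poch-split₂ _ _ N ⟩
    poch (s * q ^ a) (q ^ c * q ^ c) N * poch ((s * q ^ a) * q ^ c) (q ^ c * q ^ c) N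
      ≈⟨ *-cong (poch-cong N refl c²) (poch-cong N (monomial-shift s a c) c²) ⟩
    G s a (c ℕ.+ c) * G s (a ℕ.+ c) (c ℕ.+ c) ∎
    where
    c² = sym (^-homo-* q c c)

  pos*neg : ∀ a c → pos a c * neg a c ≈ neg (a ℕ.+ a) (c ℕ.+ c)
  pos*neg a c = begin
    pos a c * neg a c
      ≈⟨ *-cong (poch-cong N (*-identityˡ _) refl) (poch-cong N (-1*x≈-x _) refl) ⟩
    poch (q ^ a) (q ^ c) N * poch (- (q ^ a)) (q ^ c) N
      ≈⟨ poch-square (q ^ a) (q ^ c) N ⟩
    poch (- (q ^ a * q ^ a)) (q ^ c * q ^ c) N
      ≈⟨ poch-cong N (trans (-‿cong (sym (^-homo-* q a a))) (sym (-1*x≈-x _))) (sym (^-homo-* q c c)) ⟩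
    neg (a ℕ.+ a) (c ℕ.+ c) ∎

  Unit : Carrier → Set
  Unit x = Σ Carrier λ y → x * y ≈ 1#

  *-unit : ∀ {x y} → Unit x → Unit y → Unit (x * y)
  *-unit {x} {y} (u , xu≈1) (v , yv≈1) = u * v , (begin
    (x * y) * (u * v)
      ≈⟨ solve 4 (λ x y u v → (x :* y) :* (u :* v)
          := (x :* u) :* (y :* v)) refl _ _ _ _ ⟩
    (x * u) * (y * v) ≈⟨ *-cong xu≈1 yv≈1 ⟩
    1# * 1#           ≈⟨ *-identityˡ 1# ⟩
    1#                ∎)

  unit-cancel : ∀ {x y z} → Unit x → x * y ≈ x * z → y ≈ z
  unit-cancel {x} {y} {z} (u , xu≈1) xy≈xz = begin
    y            ≈⟨ recover y ⟩
    u * (x * y)  ≈⟨ *-congˡ xy≈xz ⟩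
    u * (x * z)  ≈⟨ recover z ⟨
    z            ∎
    where
    recover : ∀ t → t ≈ u * (x * t)
    recover t = begin
      t            ≈⟨ *-identityˡ t ⟨
      1# * t       ≈⟨ *-congʳ xu≈1 ⟨
      (x * u) * t  ≈⟨ solve 3 (λ x u t → (x :* u) :* t := u :* (x :* t)) refl _ _ _ ⟩
      u * (x * t)  ∎

  1+nilpotent-unit : ∀ {x} n → x ^ n ≈ 0# → Unit (1# + x)
  1+nilpotent-unit {x} n x^n≈0 = geometric n , (begin
    (1# + x) * geometric n                ≈⟨ +-identityʳ _ ⟨
    (1# + x) * geometric n + 0#           ≈⟨ +-congˡ -x^n≈0 ⟨
    (1# + x) * geometric n + (- x) ^ n    ≈⟨ geometric-sum n ⟩
    1#                                    ∎)
    where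
    geometric : ℕ → Carrier
    geometric zero    = 0#
    geometric (suc k) = 1# + - x * geometric k
    geometric-sum : ∀ k → (1# + x) * geometric k + (- x) ^ k ≈ 1#
    geometric-sum zero    = trans (+-congʳ (zeroʳ _)) (+-identityˡ 1#)
    geometric-sum (suc k) = begin
      (1# + x) * (1# + - x * geometric k) + - x * (- x) ^ k
        ≈⟨ solve 4 (λ x y g p → (con 1 :+ x) :* (con 1 :+ y :* g) :+ y :* p
                             := (con 1 :+ x) :+ y :* ((con 1 :+ x) :* g :+ p)) refl _ _ _ _ ⟩
      (1# + x) + - x * ((1# + x) * geometric k + (- x) ^ k)
        ≈⟨ +-congˡ (trans (*-congˡ (geometric-sum k)) (*-identityʳ _)) ⟩
      (1# + x) + - x          ≈⟨ +-assoc _ _ _ ⟩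
      1# + (x + - x)          ≈⟨ +-congˡ (-‿inverseʳ x) ⟩
      1# + 0#                 ≈⟨ +-identityʳ 1# ⟩
      1#                      ∎
    -x^n≈0 : (- x) ^ n ≈ 0#
    -x^n≈0 = begin
      (- x) ^ n            ≈⟨ ^-congˡ n (-1*x≈-x x) ⟨
      (- 1# * x) ^ n       ≈⟨ ^-distrib-* (- 1#) x n ⟩
      (- 1#) ^ n * x ^ n   ≈⟨ y≈0⇒x*y≈0 _ x^n≈0 ⟩
      0#                   ∎

  poch-unit : ∀ {A} Q n k → A ^ k ≈ 0# → Unit (poch A Q n)
  poch-unit Q zero    k A^k≈0 = 1# , *-identityˡ 1#
  poch-unit {A} Q (suc n) k A^k≈0 = *-unit (1+nilpotent-unit k A^k≈0)
    (poch-unit Q n k (trans (^-distrib-* A Q k) (x≈0⇒x*y≈0 _ A^k≈0)))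

  G-unit : ∀ s a c .{{_ : NonZero a}} → Unit (G s a c)
  G-unit s a c = poch-unit (q ^ c) N N (monomial-nilpotent s a)

-- Products over residue classes modulo 48

-- Classes are represented by 1, ..., m instead of 0, ..., m - 1, so that block K consists of the
-- positive parts Km + 1, ..., Km + m.
residues : ℕ → PosSet → List ℕ
residues m S = filterᵇ S (map suc (downFrom m))

module EulerProducts (R : CommutativeRing 0ℓ 0ℓ)
  (q : CommutativeRing.Carrier R) (S : PosSet) where

  open CommutativeRing R
  open Exp commutativeSemiring
  open ThetaSeries R using (poch; poch-last)
  open RingProperties ring
  open SemiringSolver commutativeSemiring using (solve; _:=_; _:+_; _:*_; con)
  open SetoidReasoning setoid

  factor : ℕ → Carrier
  factor b = if S (suc b) then 1# + - 1# * q ^ suc b else 1#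

  denominator : ℕ → Carrier
  denominator zero    = 1#
  denominator (suc b) = factor b * denominator b

  -- All that the product formula needs to know about counting: a partition with parts at most b + 1
  -- either avoids b + 1 or has one copy of it to remove.
  record GeneratedBy (P : ℕ → Carrier) : Set where
    field
      initial : P 0 ≈ 1#
      absent  : ∀ b → S (suc b) ≡ false → P (suc b) ≈ P b
      present : ∀ b → S (suc b) ≡ true → P (suc b) ≈ P b + q ^ suc b * P (suc b)

  module _ {P : ℕ → Carrier} (P-generated : GeneratedBy P) where
    open GeneratedBy P-generated

    factor*P : ∀ b → factor b * P (suc b) ≈ P b
    factor*P b with S (suc b) in eq
    ... | false = trans (*-identityˡ _) (absent b eq)
    ... | true  = begin
      (1# + - 1# * x) * P (suc b)
        ≈⟨ solve 3 (λ y x z → (con 1 :+ y :* x) :* z := z :+ y :* (x :* z)) refl _ _ _ ⟩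
      P (suc b) + - 1# * (x * P (suc b))
        ≈⟨ +-cong (present b eq) (-1*x≈-x _) ⟩
      (P b + x * P (suc b)) + - (x * P (suc b))
        ≈⟨ trans (+-assoc _ _ _) (trans (+-congˡ (-‿inverseʳ _)) (+-identityʳ _)) ⟩
      P b ∎
      where x = q ^ suc b

    denominator*P : ∀ b → denominator b * P b ≈ 1#
    denominator*P zero    = trans (*-identityˡ _) initial
    denominator*P (suc b) = begin
      (factor b * denominator b) * P (suc b)
        ≈⟨ solve 3 (λ f d p → (f :* d) :* p := d :* (f :* p)) refl _ _ _ ⟩
      denominator b * (factor b * P (suc b)) ≈⟨ *-congˡ (factor*P b) ⟩
      denominator b * P b                    ≈⟨ denominator*P b ⟩
      1#                                     ∎

  module _ {m : ℕ} (periodic : ∀ K i → S (suc (i ℕ.+ K ℕ.* m)) ≡ S (suc i)) where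

    Poch : List ℕ → ℕ → Carrier
    Poch rs K = foldr (λ r → poch (- 1# * q ^ r) (q ^ m) K *_) 1# rs

    Layer : List ℕ → ℕ → Carrier
    Layer rs K = foldr (λ r → (1# + (- 1# * q ^ r) * (q ^ m) ^ K) *_) 1# rs

    Poch-zero : ∀ rs → Poch rs 0 ≈ 1#
    Poch-zero []       = refl
    Poch-zero (r ∷ rs) = trans (*-identityˡ _) (Poch-zero rs)

    Poch-suc : ∀ rs K → Poch rs (suc K) ≈ Layer rs K * Poch rs K
    Poch-suc []       K = sym (*-identityˡ 1#)
    Poch-suc (r ∷ rs) K = trans (*-cong (poch-last (- 1# * q ^ r) (q ^ m) K) (Poch-suc rs K))
      (solve 4 (λ a b c d → (a :* b) :* (c :* d) := (a :* c) :* (b :* d)) refl _ _ _ _)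

    -- The induction runs through a partial block Km + 1, ..., Km + n, where periodicity identifies
    -- membership with that of 1, ..., n.
    layer-denominator : ∀ K n → denominator (n ℕ.+ K ℕ.* m) ≈
      Layer (filterᵇ S (map suc (downFrom n))) K * denominator (K ℕ.* m)
    layer-denominator K zero    = sym (*-identityˡ _)
    layer-denominator K (suc n) rewrite periodic K n with S (suc n)
    ... | false = trans (*-identityˡ _) (layer-denominator K n)
    ... | true  = trans (*-cong (+-congˡ monomial) (layer-denominator K n)) (sym (*-assoc _ _ _))
      where
      monomial : - 1# * q ^ suc (n ℕ.+ K ℕ.* m) ≈ (- 1# * q ^ suc n) * (q ^ m) ^ K
      monomial = begin
        - 1# * q ^ (suc n ℕ.+ K ℕ.* m)
          ≈⟨ *-congˡ (^-homo-* q (suc n) (K ℕ.* m)) ⟩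
        - 1# * (q ^ suc n * q ^ (K ℕ.* m))
          ≈⟨ *-assoc _ _ _ ⟨
        (- 1# * q ^ suc n) * q ^ (K ℕ.* m)
          ≡⟨ ≡.cong (λ e → (- 1# * q ^ suc n) * q ^ e) (ℕ.*-comm K m) ⟩
        (- 1# * q ^ suc n) * q ^ (m ℕ.* K)
          ≈⟨ *-congˡ (^-assocʳ q m K) ⟨
        (- 1# * q ^ suc n) * (q ^ m) ^ K ∎

    denominator-product : ∀ K → denominator (K ℕ.* m) ≈ Poch (residues m S) K
    denominator-product zero    = sym (Poch-zero (residues m S))
    denominator-product (suc K) = begin
      denominator (m ℕ.+ K ℕ.* m)                          ≈⟨ layer-denominator K m ⟩
      Layer (residues m S) K * denominator (K ℕ.* m)       ≈⟨ *-congˡ (denominator-product K) ⟩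
      Layer (residues m S) K * Poch (residues m S) K       ≈⟨ Poch-suc (residues m S) K ⟨
      Poch (residues m S) (suc K)                          ∎

-- The theta identity and the product identity for S and T

partsS partsT : PosSet
partsS = pmSet 47 (3 ∷ 4 ∷ 5 ∷ 6 ∷ 7 ∷ 9 ∷ 15 ∷ 16 ∷ 17 ∷ 18 ∷ 19 ∷ 21 ∷ [])
partsT = pmSet 47 (1 ∷ 3 ∷ 6 ∷ 9 ∷ 11 ∷ 13 ∷ 15 ∷ 16 ∷ 18 ∷ 20 ∷ 21 ∷ 23 ∷ [])

residuesS residuesT : List ℕ
residuesS = residues 48 partsS
residuesT = residues 48 partsT

-- Lets a rearrangement of concrete residue lists be checked by evaluation: both sorted lists
-- compute to the same normal form.
sort-injective-↭ : ∀ {xs ys} → sort xs ≡ sort ys → xs ↭ ys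
sort-injective-↭ {xs} {ys} eq = ↭-trans (↭-sym (sort-↭ xs)) (↭-trans (↭-reflexive eq) (sort-↭ ys))

module ShiftedProducts (R : CommutativeRing 0ℓ 0ℓ)
  (q : CommutativeRing.Carrier R) (N : ℕ) (q^N≈0 : Nilpotent R q N)
  (halve : Halvable R) where

  open CommutativeRing R
  open Exp commutativeSemiring
  open ThetaSeries R
  open MonomialTheta R q N q^N≈0
  open RingProperties ring
  open SemiringSolver commutativeSemiring using (solve; _:=_; _:+_; _:*_; con)
  open SetoidReasoning setoid

  Prod : List ℕ → Carrier
  Prod = foldr (λ r → neg r 48 *_) 1#

  Prod-++ : ∀ rs ss → Prod (rs ++ ss) ≈ Prod rs * Prod ss
  Prod-++ []       ss = sym (*-identityˡ _)
  Prod-++ (r ∷ rs) ss = trans (*-congˡ (Prod-++ rs ss)) (sym (*-assoc _ _ _))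

  Prod-↭ : ∀ {rs ss} → rs ↭ ss → Prod rs ≈ Prod ss
  Prod-↭ ↭.refl          = refl
  Prod-↭ (↭.prep r p)    = *-congˡ (Prod-↭ p)
  Prod-↭ (↭.swap r s p)  = trans (*-congˡ (*-congˡ (Prod-↭ p)))
    (solve 3 (λ a b c → a :* (b :* c) := b :* (a :* c)) refl _ _ _)
  Prod-↭ (↭.trans p₁ p₂) = trans (Prod-↭ p₁) (Prod-↭ p₂)

  infix  4 _⇝_
  infixr 5 _⊗_

  -- A record rather than x ≈ Prod rs, so that Agda can infer rs.
  record _⇝_ (x : Carrier) (rs : List ℕ) : Set where
    constructor expand
    field expansion : x ≈ Prod rs
  open _⇝_

  _⊗_ : ∀ {x y rs ss} → x ⇝ rs → y ⇝ ss → x * y ⇝ rs ++ ss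
  _⊗_ {rs = rs} {ss} x⇝ y⇝ =
    expand (trans (*-cong (expansion x⇝) (expansion y⇝)) (sym (Prod-++ rs ss)))

  via : ∀ {x y rs} → x ≈ y → y ⇝ rs → x ⇝ rs
  via x≈y y⇝ = expand (trans x≈y (expansion y⇝))

  neg-48 : ∀ r → neg r 48 ⇝ r ∷ []
  neg-48 r = expand (sym (*-identityʳ _))

  neg-24 : ∀ r → neg r 24 ⇝ r ∷ r ℕ.+ 24 ∷ []
  neg-24 r = via (split₂ (- 1#) r 24) (neg-48 r ⊗ neg-48 (r ℕ.+ 24))

  neg-12 : ∀ r → neg r 12 ⇝ r ∷ r ℕ.+ 24 ∷ r ℕ.+ 12 ∷ r ℕ.+ 12 ℕ.+ 24 ∷ []
  neg-12 r = via (split₂ (- 1#) r 12) (neg-24 r ⊗ neg-24 (r ℕ.+ 12))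

  neg-6 : ∀ r → neg r 6 ⇝ r ∷ r ℕ.+ 24 ∷ r ℕ.+ 12 ∷ r ℕ.+ 12 ℕ.+ 24
                        ∷ r ℕ.+ 6 ∷ r ℕ.+ 6 ℕ.+ 24 ∷ r ℕ.+ 6 ℕ.+ 12 ∷ r ℕ.+ 6 ℕ.+ 12 ℕ.+ 24 ∷ []
  neg-6 r = via (split₂ (- 1#) r 6) (neg-12 r ⊗ neg-12 (r ℕ.+ 6))

  -- S and T share the classes 3 mod 6, 6 mod 12 and ±16 mod 48. Besides these S has ±5 mod 12 and
  -- ±4 mod 48, while T has ±1 mod 12 and ±20 mod 48.
  common onlyS onlyT : Carrier
  common = neg 3 6 * (neg 6 12 * (neg 16 48 * neg 32 48))
  onlyS  = (neg 5 12 * neg 7 12) * (neg 44 48 * neg 4 48)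
  onlyT  = (neg 1 12 * neg 11 12) * (neg 20 48 * neg 28 48)

  reorder : ∀ {x rs ss} → x ⇝ rs → sort rs ≡ sort ss → x ⇝ ss
  reorder {rs = rs} {ss} x⇝ eq = expand (trans (expansion x⇝) (Prod-↭ (sort-injective-↭ {rs} {ss} eq)))

  common*onlyS : common * onlyS ⇝ residuesS
  common*onlyS = reorder
    ((neg-6 3 ⊗ neg-12 6 ⊗ neg-48 16 ⊗ neg-48 32) ⊗ (neg-12 5 ⊗ neg-12 7) ⊗ neg-48 44 ⊗ neg-48 4) ≡.refl

  common*onlyT : common * onlyT ⇝ residuesT
  common*onlyT = reorder
    ((neg-6 3 ⊗ neg-12 6 ⊗ neg-48 16 ⊗ neg-48 32) ⊗ (neg-12 1 ⊗ neg-12 11) ⊗ neg-48 20 ⊗ neg-48 28) ≡.refl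

  Prod-residuesS : Prod residuesS ≈ common * onlyS
  Prod-residuesS = sym (expansion common*onlyS)

  Prod-residuesT : Prod residuesT ≈ common * onlyT
  Prod-residuesT = sym (expansion common*onlyT)

  m M : ℕ
  m = N ℕ.+ N
  M = suc (m ℕ.* 2)

  m≤m : N ℕ.+ N ℕ.≤ m
  m≤m = ℕ.≤-refl

  m≤M : N ℕ.+ N ℕ.≤ M
  m≤M = ℕ.m≤n⇒m≤1+n (ℕ.m≤m*n m 2)

  1*1≈1 : 1# * 1# ≈ 1#
  1*1≈1 = *-identityˡ 1#

  -1*-1≈1 : - 1# * - 1# ≈ 1#
  -1*-1≈1 = trans (-1*x≈-x (- 1#)) (-‿involutive 1#)

  opposite : ∀ x → 1# * x + - 1# * x ≈ 0#
  opposite x = trans (+-cong (*-identityˡ x) (-1*x≈-x x)) (-‿inverseʳ x)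

  f₅ f₁ α β g h : Carrier
  f₅ = theta 1# 5 7 m
  f₁ = theta 1# 11 1 m
  α  = theta 1# 10 14 m
  β  = theta 1# 22 2 m
  g  = theta 1# 8 16 m
  h  = theta 1# 20 4 m

  F F² H : Carrier → Carrier
  F  s = theta s 1 2 M
  F² s = theta s 2 4 M
  H  s = theta s 1 5 M

  Y : Carrier
  Y = (pos 2 6 * (pos 4 6 * neg 3 6)) * (neg 6 6 * (neg 2 6 * neg 4 6))

  -- Used with opposite signs s and t. At modulus 6 the classes ±1 of `F s` keep the sign s and make
  -- up `H s`. The classes ±2 occur once with each sign, so their product, fixed by the last two
  -- hypotheses, does not depend on which sign is s.
  F*F² : ∀ {s t} → s * s ≈ 1# → t * t ≈ 1# → G s 2 6 * G t 2 6 ≈ pos 2 6 * neg 2 6 →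
    G s 4 6 * G t 4 6 ≈ pos 4 6 * neg 4 6 → F s * F² t ≈ Y * H s
  F*F² {s} {t} s²≈1 t²≈1 eq₂ eq₄ = begin
    F s * F² t
      ≈⟨ *-cong (trans (theta-product 1 2 s²≈1 m≤M) (*-cong (split₂ _ 3 3) (*-cong (split₂ s 1 3) (split₂ s 2 3))))
                (theta-product 2 4 t²≈1 m≤M) ⟩
    ((n₃ * n₆) * ((G s 1 6 * G s 4 6) * (G s 2 6 * G s 5 6))) * (n₆ * (G t 2 6 * G t 4 6))
      ≈⟨ solve 8 (λ n₃ n₆ s₁ s₂ s₄ s₅ t₂ t₄ →
           ((n₃ :* n₆) :* ((s₁ :* s₄) :* (s₂ :* s₅))) :* (n₆ :* (t₂ :* t₄))
           := ((s₂ :* t₂) :* (s₄ :* t₄)) :* ((n₃ :* n₆) :* (n₆ :* (s₁ :* s₅)))) refl _ _ _ _ _ _ _ _ ⟩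
    ((G s 2 6 * G t 2 6) * (G s 4 6 * G t 4 6)) * ((n₃ * n₆) * (n₆ * (G s 1 6 * G s 5 6)))
      ≈⟨ *-cong (*-cong eq₂ eq₄) refl ⟩
    ((pos 2 6 * neg 2 6) * (pos 4 6 * neg 4 6)) * ((n₃ * n₆) * (n₆ * (G s 1 6 * G s 5 6)))
      ≈⟨ solve 7 (λ p₂ n₂ p₄ n₄ n₃ n₆ z → ((p₂ :* n₂) :* (p₄ :* n₄)) :* ((n₃ :* n₆) :* z)
           := ((p₂ :* (p₄ :* n₃)) :* (n₆ :* (n₂ :* n₄))) :* z) refl _ _ _ _ _ _ _ ⟩
    Y * (n₆ * (G s 1 6 * G s 5 6))
      ≈⟨ *-congˡ (theta-product 1 5 s²≈1 m≤M) ⟨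
    Y * H s ∎
    where
    n₃ = neg 3 6
    n₆ = neg 6 6

  theta-identity : Y * g + q ^ 3 * (β * f₁) ≈ α * f₅
  theta-identity = halve (begin
    (Y * g + q ^ 3 * (β * f₁)) + (Y * g + q ^ 3 * (β * f₁))
      ≈⟨ solve 3 (λ y g z → (y :* g :+ z) :+ (y :* g :+ z) := y :* (g :+ g) :+ (z :+ z)) refl _ _ _ ⟩
    Y * (g + g) + (q ^ 3 * (β * f₁) + q ^ 3 * (β * f₁))
      ≈⟨ +-cong (*-congˡ g+g) (+-cong q³ q³) ⟩
    Y * (H 1# + H (- 1#)) + ((x * y) * (β * f₁) + (x * y) * (β * f₁))
      ≈⟨ +-congʳ (trans (distribˡ Y _ _) (+-cong
           (sym (F*F² 1*1≈1 -1*-1≈1 refl refl))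
           (sym (F*F² -1*-1≈1 1*1≈1 (*-comm _ _) (*-comm _ _))))) ⟩
    (F 1# * F² (- 1#) + F (- 1#) * F² 1#) + ((x * y) * (β * f₁) + (x * y) * (β * f₁))
      ≈⟨ +-congʳ (+-cong (*-cong (theta-dissection 1 1 m 1*1≈1) (theta-dissection 2 2 m -1*-1≈1))
                         (*-cong (theta-dissection 1 1 m -1*-1≈1) (theta-dissection 2 2 m 1*1≈1))) ⟩
    ((f₅ + x * f₁) * (α + y′ * β) + (f₅ + x′ * f₁) * (α + y * β)) + ((x * y) * (β * f₁) + (x * y) * (β * f₁))
      -- The solver has no subtraction, so opposite monomials are separate variables. Everything
      -- except 2αf₅ is a multiple of x + x′ or y + y′, both zero; the added 2xy βf₁ is what lets
      -- xy′ + x′y be absorbed.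
      ≈⟨ solve 8 (λ f₅ f₁ α β x x′ y y′ →
           ((f₅ :+ x :* f₁) :* (α :+ y′ :* β) :+ (f₅ :+ x′ :* f₁) :* (α :+ y :* β)) :+ ((x :* y) :* (β :* f₁) :+ (x :* y) :* (β :* f₁))
           := (α :* f₅ :+ α :* f₅) :+ ((x :+ x′) :* (f₁ :* α :+ y :* (f₁ :* β)) :+ (y :+ y′) :* (f₅ :* β :+ x :* (f₁ :* β)))) refl _ _ _ _ _ _ _ _ ⟩
    (α * f₅ + α * f₅) + ((x + x′) * (f₁ * α + y * (f₁ * β)) + (y + y′) * (f₅ * β + x * (f₁ * β)))
      ≈⟨ +-congˡ (trans (+-cong (x≈0⇒x*y≈0 _ (opposite (q ^ 1))) (x≈0⇒x*y≈0 _ (opposite (q ^ 2)))) (+-identityˡ 0#)) ⟩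
    (α * f₅ + α * f₅) + 0#
      ≈⟨ +-identityʳ _ ⟩
    α * f₅ + α * f₅ ∎)
    where
    x  = 1# * q ^ 1
    x′ = - 1# * q ^ 1
    y  = 1# * q ^ 2
    y′ = - 1# * q ^ 2
    q³ : q ^ 3 * (β * f₁) ≈ (x * y) * (β * f₁)
    q³ = *-congʳ (sym (monomial-square 1 2 1*1≈1))
    g+g : g + g ≈ H 1# + H (- 1#)
    g+g = sym (begin
      H 1# + H (- 1#)               ≈⟨ +-cong (theta-dissection 1 4 m 1*1≈1) (theta-dissection 1 4 m -1*-1≈1) ⟩
      (g + x * h) + (g + x′ * h)
        ≈⟨ solve 4 (λ g h x x′ → (g :+ x :* h) :+ (g :+ x′ :* h)
            := (g :+ g) :+ (x :+ x′) :* h) refl _ _ _ _ ⟩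
      (g + g) + (x + x′) * h        ≈⟨ +-congˡ (x≈0⇒x*y≈0 h (opposite (q ^ 1))) ⟩
      (g + g) + 0#                  ≈⟨ +-identityʳ _ ⟩
      g + g                         ∎)

  -- `P` runs over the classes prime to 12. It supplies the partners 1 - qʳ of the factors 1 + qʳ in
  -- `f₅` and `f₁`; the resulting 1 - q²ʳ meet the 1 + q²ʳ in `α` and `β`, which leads to modulus
  -- 48. `K` gathers the factors (Q; Q)_∞ of these thetas.
  K P : Carrier
  K = neg 24 24 * neg 12 12
  P = (neg 1 12 * neg 11 12) * (neg 5 12 * neg 7 12)

  P*αf₅ : P * (α * f₅) ≈ K * onlyT
  P*αf₅ = begin
    P * (α * f₅)
      ≈⟨ *-congˡ (*-cong (theta-product 10 14 1*1≈1 m≤m) (theta-product 5 7 1*1≈1 m≤m)) ⟩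
    P * ((neg 24 24 * (pos 10 24 * pos 14 24)) * (neg 12 12 * (pos 5 12 * pos 7 12)))
      ≈⟨ solve 9 (λ u n₅ n₇ e p₁₀ p₁₄ k p₅ p₇ →
           (u :* (n₅ :* n₇)) :* ((e :* (p₁₀ :* p₁₄)) :* (k :* (p₅ :* p₇)))
           := (e :* k) :* (u :* ((p₁₀ :* (p₅ :* n₅)) :* (p₁₄ :* (p₇ :* n₇))))) refl _ _ _ _ _ _ _ _ _ ⟩
    K * ((neg 1 12 * neg 11 12) * ((pos 10 24 * (pos 5 12 * neg 5 12)) * (pos 14 24 * (pos 7 12 * neg 7 12))))
      ≈⟨ *-congˡ (*-congˡ (*-cong (trans (*-congˡ (pos*neg 5 12)) (pos*neg 10 24))
                                  (trans (*-congˡ (pos*neg 7 12)) (pos*neg 14 24)))) ⟩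
    K * onlyT ∎

  P*βf₁ : P * (β * f₁) ≈ K * onlyS
  P*βf₁ = begin
    P * (β * f₁)
      ≈⟨ *-congˡ (*-cong (theta-product 22 2 1*1≈1 m≤m) (theta-product 11 1 1*1≈1 m≤m)) ⟩
    P * ((neg 24 24 * (pos 22 24 * pos 2 24)) * (neg 12 12 * (pos 11 12 * pos 1 12)))
      ≈⟨ solve 9 (λ u n₁ n₁₁ e p₂₂ p₂ k p₁₁ p₁ →
           ((n₁ :* n₁₁) :* u) :* ((e :* (p₂₂ :* p₂)) :* (k :* (p₁₁ :* p₁)))
           := (e :* k) :* (u :* ((p₂₂ :* (p₁₁ :* n₁₁)) :* (p₂ :* (p₁ :* n₁))))) refl _ _ _ _ _ _ _ _ _ ⟩
    K * ((neg 5 12 * neg 7 12) * ((pos 22 24 * (pos 11 12 * neg 11 12)) * (pos 2 24 * (pos 1 12 * neg 1 12))))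
      ≈⟨ *-congˡ (*-congˡ (*-cong (trans (*-congˡ (pos*neg 11 12)) (pos*neg 22 24))
                                  (trans (*-congˡ (pos*neg 1 12)) (pos*neg 2 24)))) ⟩
    K * onlyS ∎

  -- The factors of `g` complete the classes 8 and 16 mod 24 of `Y` to the ±16 mod 48 of `common`.
  -- The classes 4 and 20 mod 24 split into 4, 28, 20, 44 mod 48, of which 4 and 44 go to `onlyS`,
  -- 20 and 28 to `onlyT`.
  P*Yg : P * (Y * g) ≈ K * ((common * onlyS) * onlyT)
  P*Yg = begin
    P * (Y * g)
      ≈⟨ *-congˡ (*-cong Y≈ (theta-product 8 16 1*1≈1 m≤m)) ⟩
    P * (((neg 3 6 * (neg 6 12 * neg 12 12)) * ((neg 4 24 * neg 16 24) * (neg 8 24 * neg 20 24)))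
         * (neg 24 24 * (pos 8 24 * pos 16 24)))
      ≈⟨ solve 11 (λ p n₃ n₆ k n₄ n₁₆ n₈ n₂₀ e p₈ p₁₆ →
           p :* (((n₃ :* (n₆ :* k)) :* ((n₄ :* n₁₆) :* (n₈ :* n₂₀))) :* (e :* (p₈ :* p₁₆)))
           := (e :* k) :* ((p :* (n₃ :* (n₆ :* ((p₈ :* n₈) :* (p₁₆ :* n₁₆))))) :* (n₄ :* n₂₀)))
           refl _ _ _ _ _ _ _ _ _ _ _ ⟩
    K * ((P * (neg 3 6 * (neg 6 12 * ((pos 8 24 * neg 8 24) * (pos 16 24 * neg 16 24))))) * (neg 4 24 * neg 20 24))
      ≈⟨ *-congˡ (*-cong (*-congˡ (*-congˡ (*-congˡ (*-cong (pos*neg 8 24) (pos*neg 16 24)))))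
                         (*-cong (split₂ _ 4 24) (split₂ _ 20 24))) ⟩
    K * ((P * common) * ((neg 4 48 * neg 28 48) * (neg 20 48 * neg 44 48)))
      ≈⟨ *-congˡ (solve 7 (λ u v c n₄ n₂₈ n₂₀ n₄₄ →
           ((u :* v) :* c) :* ((n₄ :* n₂₈) :* (n₂₀ :* n₄₄))
           := (c :* (v :* (n₄₄ :* n₄))) :* (u :* (n₂₀ :* n₂₈))) refl _ _ _ _ _ _ _) ⟩
    K * ((common * onlyS) * onlyT) ∎
    where
    Y≈ : Y ≈ (neg 3 6 * (neg 6 12 * neg 12 12)) * ((neg 4 24 * neg 16 24) * (neg 8 24 * neg 20 24))
    Y≈ = begin
      Y ≈⟨ solve 6 (λ p₂ p₄ n₃ n₆ n₂ n₄ → (p₂ :* (p₄ :* n₃)) :* (n₆ :* (n₂ :* n₄))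
                   := (n₃ :* n₆) :* ((p₂ :* n₂) :* (p₄ :* n₄))) refl _ _ _ _ _ _ ⟩
      (neg 3 6 * neg 6 6) * ((pos 2 6 * neg 2 6) * (pos 4 6 * neg 4 6))
        ≈⟨ *-cong (*-congˡ (split₂ _ 6 6)) (*-cong (trans (pos*neg 2 6) (split₂ _ 4 12))
                                                   (trans (pos*neg 4 6) (split₂ _ 8 12))) ⟩
      (neg 3 6 * (neg 6 12 * neg 12 12)) * ((neg 4 24 * neg 16 24) * (neg 8 24 * neg 20 24)) ∎

  reduced-identity : (common * onlyS) * onlyT + q ^ 3 * onlyS ≈ onlyT
  reduced-identity = unit-cancel (*-unit (G-unit _ 24 24) (G-unit _ 12 12)) (begin
    K * ((common * onlyS) * onlyT + q ^ 3 * onlyS)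
      ≈⟨ solve 4 (λ k x q s → k :* (x :+ q :* s) := k :* x :+ q :* (k :* s)) refl _ _ _ _ ⟩
    K * ((common * onlyS) * onlyT) + q ^ 3 * (K * onlyS)
      ≈⟨ +-cong P*Yg (*-congˡ P*βf₁) ⟨
    P * (Y * g) + q ^ 3 * (P * (β * f₁))
      ≈⟨ solve 4 (λ p x q s → p :* x :+ q :* (p :* s) := p :* (x :+ q :* s)) refl _ _ _ _ ⟩
    P * (Y * g + q ^ 3 * (β * f₁))
      ≈⟨ *-congˡ theta-identity ⟩
    P * (α * f₅)
      ≈⟨ P*αf₅ ⟩
    K * onlyT ∎)

  product-identity : Prod residuesS * Prod residuesT + q ^ 3 * Prod residuesS ≈ Prod residuesT
  product-identity = begin
    Prod residuesS * Prod residuesT + q ^ 3 * Prod residuesS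
      ≈⟨ +-cong (*-cong Prod-residuesS Prod-residuesT) (*-congˡ Prod-residuesS) ⟩
    (common * onlyS) * (common * onlyT) + q ^ 3 * (common * onlyS)
      ≈⟨ solve 4 (λ c s t q → (c :* s) :* (c :* t) :+ q :* (c :* s)
            := c :* ((c :* s) :* t :+ q :* s)) refl _ _ _ _ ⟩
    common * ((common * onlyS) * onlyT + q ^ 3 * onlyS)
      ≈⟨ *-congˡ reduced-identity ⟩
    common * onlyT
      ≈⟨ Prod-residuesT ⟨
    Prod residuesT ∎

  shifted-inverses : ∀ {x y} → Prod residuesS * x ≈ 1# → Prod residuesT * y ≈ 1# → x ≈ 1# + q ^ 3 * y
  shifted-inverses {x} {y} Sx≈1 Ty≈1 = begin
    x
      ≈⟨ trans (*-congˡ Ty≈1) (*-identityʳ x) ⟨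
    x * (Prod residuesT * y)
      ≈⟨ *-congˡ (*-congʳ product-identity) ⟨
    x * ((Prod residuesS * Prod residuesT + q ^ 3 * Prod residuesS) * y)
      ≈⟨ solve 5 (λ x y s t q → x :* ((s :* t :+ q :* s) :* y)
            := (s :* x) :* (t :* y) :+ q :* ((s :* x) :* y)) refl _ _ _ _ _ ⟩
    (Prod residuesS * x) * (Prod residuesT * y) + q ^ 3 * ((Prod residuesS * x) * y)
      ≈⟨ +-cong (trans (*-cong Sx≈1 Ty≈1) (*-identityˡ 1#)) (*-congˡ (trans (*-congʳ Sx≈1) (*-identityˡ y))) ⟩
    1# + q ^ 3 * y ∎

-- Formal power series

Series : Set
Series = ℕ → ℤ

module _ where
  open ℤ.+-*-Solver
  open ≡.≡-Reasoning

  infixl 6 _⊞_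
  infixl 7 _⊠_

  -- The Cauchy product, read off from f = f₀ + q · (f ∘ suc).
  _⊞_ _⊠_ : Series → Series → Series
  (f ⊞ g) n = f n ℤ.+ g n
  (f ⊠ g) zero    = f 0 ℤ.* g 0
  (f ⊠ g) (suc n) = f 0 ℤ.* g (suc n) ℤ.+ (f ∘ suc ⊠ g) n

  ⊟_ : Series → Series
  (⊟ f) n = ℤ.- f n

  𝟘 𝟙 : Series
  𝟘 _       = 0ℤ
  𝟙 zero    = 1ℤ
  𝟙 (suc _) = 0ℤ

  -- Only coefficients up to n influence the n-th one; this makes agreement below a bound compatible
  -- with products.
  ⊠-cong : ∀ {f f′ g g′} n → (∀ i → i ℕ.≤ n → f i ≡ f′ i) → (∀ i → i ℕ.≤ n → g i ≡ g′ i) →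
    (f ⊠ g) n ≡ (f′ ⊠ g′) n
  ⊠-cong zero    f≡ g≡ = ≡.cong₂ ℤ._*_ (f≡ 0 z≤n) (g≡ 0 z≤n)
  ⊠-cong (suc n) f≡ g≡ = ≡.cong₂ ℤ._+_
    (≡.cong₂ ℤ._*_ (f≡ 0 z≤n) (g≡ (suc n) ℕ.≤-refl))
    (⊠-cong n (λ i i≤n → f≡ (suc i) (s≤s i≤n)) (λ i i≤n → g≡ i (ℕ.m≤n⇒m≤1+n i≤n)))

  𝟘⊠ : ∀ g n → (𝟘 ⊠ g) n ≡ 0ℤ
  𝟘⊠ g zero    = ≡.refl
  𝟘⊠ g (suc n) = ≡.trans (ℤ.+-identityˡ _) (𝟘⊠ g n)

  𝟙⊠ : ∀ g n → (𝟙 ⊠ g) n ≡ g n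
  𝟙⊠ g zero    = ℤ.*-identityˡ (g 0)
  𝟙⊠ g (suc n) = ≡.trans (≡.cong₂ ℤ._+_ (ℤ.*-identityˡ (g (suc n))) (𝟘⊠ g n)) (ℤ.+-identityʳ _)

  ⊠-distribʳ : ∀ h f g n → ((f ⊞ g) ⊠ h) n ≡ (f ⊠ h ⊞ g ⊠ h) n
  ⊠-distribʳ h f g zero    = ℤ.*-distribʳ-+ (h 0) (f 0) (g 0)
  ⊠-distribʳ h f g (suc n) = begin
    (f 0 ℤ.+ g 0) ℤ.* h (suc n) ℤ.+ ((f ∘ suc ⊞ g ∘ suc) ⊠ h) n
      ≡⟨ ≡.cong (ℤ._+_ ((f 0 ℤ.+ g 0) ℤ.* h (suc n))) (⊠-distribʳ h (f ∘ suc) (g ∘ suc) n) ⟩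
    (f 0 ℤ.+ g 0) ℤ.* h (suc n) ℤ.+ ((f ∘ suc ⊠ h) n ℤ.+ (g ∘ suc ⊠ h) n)
      ≡⟨ solve 5 (λ a b c u v → (a :+ b) :* c :+ (u :+ v) := (a :* c :+ u) :+ (b :* c :+ v)) ≡.refl
           (f 0) (g 0) (h (suc n)) ((f ∘ suc ⊠ h) n) ((g ∘ suc ⊠ h) n) ⟩
    (f ⊠ h ⊞ g ⊠ h) (suc n) ∎

  ⊠-scale : ∀ c f g n → ((λ i → c ℤ.* f i) ⊠ g) n ≡ c ℤ.* (f ⊠ g) n
  ⊠-scale c f g zero    = ℤ.*-assoc c (f 0) (g 0)
  ⊠-scale c f g (suc n) = ≡.trans (≡.cong (ℤ._+_ (c ℤ.* f 0 ℤ.* g (suc n))) (⊠-scale c (f ∘ suc) g n))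
    (solve 4 (λ c a b u → c :* a :* b :+ c :* u
          := c :* (a :* b :+ u)) ≡.refl c (f 0) (g (suc n)) ((f ∘ suc ⊠ g) n))

  ⊠-sucʳ : ∀ f g n → (f ⊠ g) (suc n) ≡ (f ⊠ g ∘ suc) n ℤ.+ f (suc n) ℤ.* g 0
  ⊠-sucʳ f g zero    = ≡.refl
  ⊠-sucʳ f g (suc n) = ≡.trans (≡.cong (ℤ._+_ (f 0 ℤ.* g (suc (suc n)))) (⊠-sucʳ (f ∘ suc) g n))
    (≡.sym (ℤ.+-assoc (f 0 ℤ.* g (suc (suc n))) ((f ∘ suc ⊠ g ∘ suc) n) (f (suc (suc n)) ℤ.* g 0)))

  ⊠-comm : ∀ f g n → (f ⊠ g) n ≡ (g ⊠ f) n
  ⊠-comm f g zero    = ℤ.*-comm (f 0) (g 0)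
  ⊠-comm f g (suc n) = begin
    f 0 ℤ.* g (suc n) ℤ.+ (f ∘ suc ⊠ g) n  ≡⟨ ≡.cong₂ ℤ._+_ (ℤ.*-comm (f 0) (g (suc n))) (⊠-comm (f ∘ suc) g n) ⟩
    g (suc n) ℤ.* f 0 ℤ.+ (g ⊠ f ∘ suc) n  ≡⟨ ℤ.+-comm (g (suc n) ℤ.* f 0) ((g ⊠ f ∘ suc) n) ⟩
    (g ⊠ f ∘ suc) n ℤ.+ g (suc n) ℤ.* f 0  ≡⟨ ⊠-sucʳ g f n ⟨
    (g ⊠ f) (suc n)                        ∎

  ⊠-assoc : ∀ f g h n → (f ⊠ g ⊠ h) n ≡ (f ⊠ (g ⊠ h)) n
  ⊠-assoc f g h zero    = ℤ.*-assoc (f 0) (g 0) (h 0)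
  ⊠-assoc f g h (suc n) = begin
    f 0 ℤ.* g 0 ℤ.* h (suc n) ℤ.+ (((λ i → f 0 ℤ.* g (suc i)) ⊞ (f ∘ suc ⊠ g)) ⊠ h) n
      -- By definition (f ⊠ g) ∘ suc is f₀ times g ∘ suc plus f ∘ suc ⊠ g, so distributivity and
      -- scaling apply.
      ≡⟨ ≡.cong (ℤ._+_ (f 0 ℤ.* g 0 ℤ.* h (suc n))) (⊠-distribʳ h (λ i → f 0 ℤ.* g (suc i)) (f ∘ suc ⊠ g) n) ⟩
    f 0 ℤ.* g 0 ℤ.* h (suc n) ℤ.+ (((λ i → f 0 ℤ.* g (suc i)) ⊠ h) n ℤ.+ ((f ∘ suc ⊠ g) ⊠ h) n)
      ≡⟨ ≡.cong (ℤ._+_ (f 0 ℤ.* g 0 ℤ.* h (suc n))) (≡.cong₂ ℤ._+_ (⊠-scale (f 0) (g ∘ suc) h n) (⊠-assoc (f ∘ suc) g h n)) ⟩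
    f 0 ℤ.* g 0 ℤ.* h (suc n) ℤ.+ (f 0 ℤ.* (g ∘ suc ⊠ h) n ℤ.+ (f ∘ suc ⊠ (g ⊠ h)) n)
      ≡⟨ solve 5 (λ a b c u v → a :* b :* c :+ (a :* u :+ v) := a :* (b :* c :+ u) :+ v) ≡.refl
           (f 0) (g 0) (h (suc n)) ((g ∘ suc ⊠ h) n) ((f ∘ suc ⊠ (g ⊠ h)) n) ⟩
    (f ⊠ (g ⊠ h)) (suc n) ∎

module TruncatedSeries (N : ℕ) where

  infix 4 _≈_
  -- Congruence modulo q^N: the series stay whole and only equality is coarsened.
  _≈_ : Series → Series → Set
  f ≈ g = ∀ n → n ℕ.< N → f n ≡ g n

  pointwise : ∀ {f g : Series} → (∀ n → f n ≡ g n) → f ≈ g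
  pointwise f≡g n _ = f≡g n

  isCommutativeRing : IsCommutativeRing _≈_ _⊞_ _⊠_ ⊟_ 𝟘 𝟙
  isCommutativeRing = record
    { isRing = record
      { +-isAbelianGroup = record
        { isGroup = record
          { isMonoid = record
            { isSemigroup = record
              { isMagma = record
                { isEquivalence = record
                  { refl  = λ _ _ → ≡.refl
                  ; sym   = λ f≈g n n<N → ≡.sym (f≈g n n<N)
                  ; trans = λ f≈g g≈h n n<N → ≡.trans (f≈g n n<N) (g≈h n n<N)
                  }
                ; ∙-cong = λ f≈f′ g≈g′ n n<N → ≡.cong₂ ℤ._+_ (f≈f′ n n<N) (g≈g′ n n<N)
                }
              ; assoc = λ f g h → pointwise (λ n → ℤ.+-assoc (f n) (g n) (h n))
              }
            ; identity = (λ f → pointwise (ℤ.+-identityˡ ∘ f)) , (λ f → pointwise (ℤ.+-identityʳ ∘ f))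
            }
          ; inverse = (λ f → pointwise (ℤ.+-inverseˡ ∘ f)) , (λ f → pointwise (ℤ.+-inverseʳ ∘ f))
          ; ⁻¹-cong = λ f≈g n n<N → ≡.cong ℤ.-_ (f≈g n n<N)
          }
        ; comm = λ f g → pointwise (λ n → ℤ.+-comm (f n) (g n))
        }
      ; *-cong = λ f≈f′ g≈g′ n n<N → ⊠-cong n
          (λ i i≤n → f≈f′ i (ℕ.≤-<-trans i≤n n<N)) (λ i i≤n → g≈g′ i (ℕ.≤-<-trans i≤n n<N))
      ; *-assoc = λ f g h → pointwise (⊠-assoc f g h)
      ; *-identity = (λ f → pointwise (𝟙⊠ f))
                   , (λ f → pointwise (λ n → ≡.trans (⊠-comm f 𝟙 n) (𝟙⊠ f n)))
      ; distrib = (λ f g h → pointwise (λ n → ≡.trans (⊠-comm f (g ⊞ h) n)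
                    (≡.trans (⊠-distribʳ f g h n) (≡.cong₂ ℤ._+_ (⊠-comm g f n) (⊠-comm h f n)))))
                , (λ h f g → pointwise (⊠-distribʳ h f g))
      }
    ; *-comm = λ f g → pointwise (⊠-comm f g)
    }

  commutativeRing : CommutativeRing 0ℓ 0ℓ
  commutativeRing = record { isCommutativeRing = isCommutativeRing }

  open Exp (CommutativeRing.commutativeSemiring commutativeRing) using (_^_)

  q : Series
  q zero    = 0ℤ
  q (suc n) = 𝟙 n

  q⊠-suc : ∀ f n → (q ⊠ f) (suc n) ≡ f n
  q⊠-suc f n = ≡.trans (ℤ.+-identityˡ _) (𝟙⊠ f n)

  q^-shift : ∀ c f n → (q ^ c ⊠ f) (c ℕ.+ n) ≡ f n
  q^-shift zero    f n = 𝟙⊠ f n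
  q^-shift (suc c) f n = ≡.trans (⊠-assoc q (q ^ c) f (suc (c ℕ.+ n)))
    (≡.trans (q⊠-suc (q ^ c ⊠ f) (c ℕ.+ n)) (q^-shift c f n))

  q^-low : ∀ c f {n} → n ℕ.< c → (q ^ c ⊠ f) n ≡ 0ℤ
  q^-low (suc c) f {zero}  _         = ⊠-assoc q (q ^ c) f 0
  q^-low (suc c) f {suc n} (s≤s n<c) = ≡.trans (⊠-assoc q (q ^ c) f (suc n))
    (≡.trans (q⊠-suc (q ^ c ⊠ f) n) (q^-low c f n<c))

  q^N≈0 : q ^ N ≈ 𝟘
  q^N≈0 n n<N = ≡.trans (≡.sym (≡.trans (⊠-comm (q ^ N) 𝟙 n) (𝟙⊠ (q ^ N) n))) (q^-low N 𝟙 n<N)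

  halve : ∀ {f g} → f ⊞ f ≈ g ⊞ g → f ≈ g
  halve {f} {g} 2f≈2g n n<N = ℤ.*-cancelˡ-≡ (+ 2) (f n) (g n)
    (≡.trans (twice (f n)) (≡.trans (2f≈2g n n<N) (≡.sym (twice (g n)))))
    where
    open ℤ.+-*-Solver
    twice : ∀ x → + 2 ℤ.* x ≡ x ℤ.+ x
    twice = solve 1 (λ x → con (+ 2) :* x := x :+ x) ≡.refl

-- Counting partitions

∑ℕ : (ℕ → ℕ) → ℕ → ℕ
∑ℕ f zero    = 0
∑ℕ f (suc n) = f 0 ℕ.+ ∑ℕ (f ∘ suc) n

∑ℕ-cong : ∀ {f g} n → (∀ i → f i ≡ g i) → ∑ℕ f n ≡ ∑ℕ g n
∑ℕ-cong zero    f≡g = ≡.refl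
∑ℕ-cong (suc n) f≡g = ≡.cong₂ ℕ._+_ (f≡g 0) (∑ℕ-cong n (f≡g ∘ suc))

∑ℕ-zero : ∀ {f} n → (∀ i → f i ≡ 0) → ∑ℕ f n ≡ 0
∑ℕ-zero zero    f≡0 = ≡.refl
∑ℕ-zero (suc n) f≡0 = ≡.cong₂ ℕ._+_ (f≡0 0) (∑ℕ-zero n (f≡0 ∘ suc))

∑ℕ-extend : ∀ f k {n} → (∀ i → f (n ℕ.+ i) ≡ 0) → ∑ℕ f (n ℕ.+ k) ≡ ∑ℕ f n
∑ℕ-extend f k {zero}  f≡0 = ∑ℕ-zero k f≡0
∑ℕ-extend f k {suc n} f≡0 = ≡.cong (f 0 ℕ.+_) (∑ℕ-extend (f ∘ suc) k f≡0)

length-concatMap-applyUpTo : ∀ {A B : Set} (F : A → List B) f n →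
  length (concatMap F (applyUpTo f n)) ≡ ∑ℕ (length ∘ F ∘ f) n
length-concatMap-applyUpTo F f zero    = ≡.refl
length-concatMap-applyUpTo F f (suc n) = ≡.trans (List.length-++ (F (f 0)))
  (≡.cong (length (F (f 0)) ℕ.+_) (length-concatMap-applyUpTo F (f ∘ suc) n))

count : PosSet → ℕ → ℕ → ℕ
count S b n = length (partitionsLE S b n)

multiplicity : (ℕ → ℕ) → ℕ → ℕ → ℕ → ℕ
multiplicity f c n j = if (j ℕ.* c) ≤ᵇ n then f (n ℕ.∸ j ℕ.* c) else 0

multiplicity-low : ∀ f c n j → n ℕ.< j ℕ.* c → multiplicity f c n j ≡ 0
multiplicity-low f c n j n<jc with j ℕ.* c ≤ᵇ n in eq
... | false = ≡.refl
... | true  = contradiction (ℕ.≤ᵇ⇒≤ (j ℕ.* c) n (≡.subst T (≡.sym eq) _)) (ℕ.<⇒≱ n<jc)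

suc-≤ᵇ-suc : ∀ m n → (suc m ≤ᵇ suc n) ≡ (m ≤ᵇ n)
suc-≤ᵇ-suc zero    n = ≡.refl
suc-≤ᵇ-suc (suc m) n = ≡.refl

+-≤ᵇ-+ : ∀ k m n → (k ℕ.+ m ≤ᵇ k ℕ.+ n) ≡ (m ≤ᵇ n)
+-≤ᵇ-+ zero    m n = ≡.refl
+-≤ᵇ-+ (suc k) m n = ≡.trans (suc-≤ᵇ-suc (k ℕ.+ m) (k ℕ.+ n)) (+-≤ᵇ-+ k m n)

multiplicity-shift : ∀ f c n j → multiplicity f c (c ℕ.+ n) (suc j) ≡ multiplicity f c n j
multiplicity-shift f c n j = ≡.cong₂ (λ t x → if t then f x else 0)
  (+-≤ᵇ-+ c (j ℕ.* c) n) (ℕ.[m+n]∸[m+o]≡n∸o c n (j ℕ.* c))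

module _ (S : PosSet) (b : ℕ) where

  open ≡.≡-Reasoning

  count-absent : S (suc b) ≡ false → ∀ n → count S (suc b) n ≡ count S b n
  count-absent b∉S n rewrite b∉S = ≡.refl

  withMultiplicity : ℕ → ℕ → List (List ℕ)
  withMultiplicity n j = if (j ℕ.* suc b) ≤ᵇ n
    then map (replicate j (suc b) ++_) (partitionsLE S b (n ℕ.∸ j ℕ.* suc b))
    else []

  length-withMultiplicity : ∀ n j →
    length (withMultiplicity n j) ≡ multiplicity (count S b) (suc b) n j
  length-withMultiplicity n j with (j ℕ.* suc b) ≤ᵇ n
  ... | true  = List.length-map _ (partitionsLE S b (n ℕ.∸ j ℕ.* suc b))
  ... | false = ≡.refl

  count-present : S (suc b) ≡ true → ∀ n →
    count S (suc b) n ≡ ∑ℕ (multiplicity (count S b) (suc b) n) (suc n)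
  count-present b∈S n rewrite b∈S = ≡.trans
    (length-concatMap-applyUpTo (withMultiplicity n) (λ j → j) (suc n))
    (∑ℕ-cong (suc n) (length-withMultiplicity n))

  count-low : ∀ {n} → n ℕ.< suc b → count S (suc b) n ≡ count S b n
  count-low {n} n<1+b = low (S (suc b)) ≡.refl
    where
    low : ∀ t → S (suc b) ≡ t → count S (suc b) n ≡ count S b n
    low false b∉S = count-absent b∉S n
    low true  b∈S = ≡.trans (count-present b∈S n) (≡.trans
      (≡.cong (count S b n ℕ.+_) (∑ℕ-zero n (λ j → multiplicity-low (count S b) (suc b) n (suc j)
        (ℕ.<-≤-trans n<1+b (ℕ.m≤m+n (suc b) (j ℕ.* suc b))))))
      (ℕ.+-identityʳ _))

  -- Multiplicity 0 gives the first summand; otherwise removing one copy of b + 1 lowers the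
  -- multiplicity by 1 and the total by b + 1.
  count-step : S (suc b) ≡ true → ∀ n →
    count S (suc b) (suc b ℕ.+ n) ≡ count S b (suc b ℕ.+ n) ℕ.+ count S (suc b) n
  count-step b∈S n = ≡.trans (count-present b∈S (suc b ℕ.+ n)) (≡.cong (count S b (suc b ℕ.+ n) ℕ.+_) (begin
    ∑ℕ (μ (suc b ℕ.+ n) ∘ suc) (suc b ℕ.+ n)
      ≡⟨ ∑ℕ-cong (suc b ℕ.+ n) (multiplicity-shift (count S b) (suc b) n) ⟩
    ∑ℕ (μ n) (suc b ℕ.+ n)
      ≡⟨ ≡.cong (∑ℕ (μ n)) (≡.cong suc (ℕ.+-comm b n)) ⟩
    ∑ℕ (μ n) (suc n ℕ.+ b)
      -- A multiplicity above n would already exceed the total, so the extra `b` terms are zero.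
      ≡⟨ ∑ℕ-extend (μ n) b {suc n} (λ i → multiplicity-low (count S b) (suc b) n (suc n ℕ.+ i)
           (ℕ.<-≤-trans (ℕ.m≤m+n (suc n) i) (ℕ.m≤m*n (suc n ℕ.+ i) (suc b)))) ⟩
    ∑ℕ (μ n) (suc n)
      ≡⟨ count-present b∈S n ⟨
    count S (suc b) n ∎))
    where
    μ : ℕ → ℕ → ℕ
    μ = multiplicity (count S b) (suc b)

count-stable : ∀ S k n → count S (k ℕ.+ n) n ≡ p S n
count-stable S zero    n = ≡.refl
count-stable S (suc k) n = ≡.trans (count-low S (k ℕ.+ n) (s≤s (ℕ.m≤n+m n k))) (count-stable S k n)

pmSet-periodic : ∀ m rs K i → pmSet m rs (suc (i ℕ.+ K ℕ.* suc m)) ≡ pmSet m rs (suc i)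
pmSet-periodic m []       K i = ≡.refl
pmSet-periodic m (r ∷ rs) K i = ≡.cong₂ _∨_
  (≡.cong₂ (λ x y → (x ≡ᵇ (r % suc m)) ∨ (y ≡ᵇ 0))
    ([m+kn]%n≡m%n (suc i) K (suc m))
    (≡.trans (≡.cong (_% suc m) (solve 3 (λ i k r → (i :+ k) :+ r
          := (i :+ r) :+ k) ≡.refl (suc i) (K ℕ.* suc m) r))
           ([m+kn]%n≡m%n (suc i ℕ.+ r) K (suc m))))
  (pmSet-periodic m rs K i)
  where open ℕ.+-*-Solver

-- Truncated generating series of the partition counts

module _ (N : ℕ) where

  open TruncatedSeries N

  countSeries : PosSet → ℕ → Series
  countSeries S b n = + count S b n

  countSeries-generated : ∀ S → EulerProducts.GeneratedBy commutativeRing q S (countSeries S)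
  countSeries-generated S = record
    { initial = λ { zero _ → ≡.refl ; (suc n) _ → ≡.refl }
    ; absent  = λ b b∉S → pointwise (λ n → ≡.cong +_ (count-absent S b b∉S n))
    ; present = λ b b∈S → pointwise (present b b∈S)
    }
    where
    open ≡.≡-Reasoning
    open Exp (CommutativeRing.commutativeSemiring commutativeRing) using (_^_)
    present : ∀ b → S (suc b) ≡ true → ∀ n →
      countSeries S (suc b) n ≡ (countSeries S b ⊞ q ^ suc b ⊠ countSeries S (suc b)) n
    present b b∈S n with ℕ.<-≤-connex n (suc b)
    ... | inj₁ n<1+b = begin
      + count S (suc b) n         ≡⟨ ≡.cong +_ (count-low S b n<1+b) ⟩
      + count S b n               ≡⟨ ℤ.+-identityʳ _ ⟨
      + count S b n ℤ.+ 0ℤ        ≡⟨ ≡.cong (ℤ._+_ (countSeries S b n)) (q^-low (suc b) (countSeries S (suc b)) n<1+b) ⟨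
      (countSeries S b ⊞ q ^ suc b ⊠ countSeries S (suc b)) n ∎
    ... | inj₂ 1+b≤n = ≡.subst
      (λ k → countSeries S (suc b) k ≡ (countSeries S b ⊞ q ^ suc b ⊠ countSeries S (suc b)) k)
      (ℕ.m+[n∸m]≡n 1+b≤n) (high (n ℕ.∸ suc b))
      where
      high : ∀ k → countSeries S (suc b) (suc b ℕ.+ k)
                 ≡ (countSeries S b ⊞ q ^ suc b ⊠ countSeries S (suc b)) (suc b ℕ.+ k)
      high k = begin
        + count S (suc b) (suc b ℕ.+ k)
          ≡⟨ ≡.cong +_ (count-step S b b∈S k) ⟩
        + count S b (suc b ℕ.+ k) ℤ.+ + count S (suc b) k
          ≡⟨ ≡.cong (ℤ._+_ (countSeries S b (suc b ℕ.+ k))) (q^-shift (suc b) (countSeries S (suc b)) k) ⟨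
        (countSeries S b ⊞ q ^ suc b ⊠ countSeries S (suc b)) (suc b ℕ.+ k) ∎

  countSeries-inverse : ∀ m rs →
    EulerProducts.Poch commutativeRing q (pmSet m rs) (pmSet-periodic m rs) (residues (suc m) (pmSet m rs)) N
      ⊠ countSeries (pmSet m rs) (N ℕ.* suc m) ≈ 𝟙
  countSeries-inverse m rs = trans
    (*-congʳ {countSeries S (N ℕ.* suc m)} (sym {denominator (N ℕ.* suc m)}
      (denominator-product (pmSet-periodic m rs) N)))
    (denominator*P (countSeries-generated S) (N ℕ.* suc m))
    where
    S = pmSet m rs
    open CommutativeRing commutativeRing using (trans; sym; *-congʳ)
    open EulerProducts commutativeRing q S

  open Exp (CommutativeRing.commutativeSemiring commutativeRing) using (_^_)

  countSeries-shifted :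
    countSeries partsS (N ℕ.* 48) ≈ 𝟙 ⊞ q ^ 3 ⊠ countSeries partsT (N ℕ.* 48)
  countSeries-shifted = ShiftedProducts.shifted-inverses commutativeRing q N q^N≈0 (λ {f} {g} → halve {f} {g})
    -- With parts up to 48N every residue class contributes exactly `N` factors, so `Poch` is
    -- definitionally the `Prod` of the residues.
    (countSeries-inverse 47 _) (countSeries-inverse 47 _)

  countSeries-complete : ∀ S {n} → n ℕ.< N → countSeries S (N ℕ.* 48) n ≡ + p S n
  countSeries-complete S {n} n<N = ≡.cong +_ (≡.trans
    (≡.cong (λ b → count S b n) (≡.sym (ℕ.m∸n+n≡m (ℕ.≤-trans (ℕ.<⇒≤ n<N) (ℕ.m≤m*n N 48)))))
    (count-stable S (N ℕ.* 48 ℕ.∸ n) n))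

  p-shifted : ∀ n → 3 ℕ.+ n ℕ.< N → p partsS (3 ℕ.+ n) ≡ p partsT n
  p-shifted n 3+n<N = ℤ.+-injective (begin
    + p partsS (3 ℕ.+ n)
      ≡⟨ countSeries-complete partsS 3+n<N ⟨
    countSeries partsS (N ℕ.* 48) (3 ℕ.+ n)
      ≡⟨ countSeries-shifted (3 ℕ.+ n) 3+n<N ⟩
    0ℤ ℤ.+ (q ^ 3 ⊠ countSeries partsT (N ℕ.* 48)) (3 ℕ.+ n)
      ≡⟨ ℤ.+-identityˡ _ ⟩
    (q ^ 3 ⊠ countSeries partsT (N ℕ.* 48)) (3 ℕ.+ n)
      ≡⟨ q^-shift 3 (countSeries partsT (N ℕ.* 48)) n ⟩
    countSeries partsT (N ℕ.* 48) n
      ≡⟨ countSeries-complete partsT (ℕ.≤-<-trans (ℕ.m≤n+m n 3) 3+n<N) ⟩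
    + p partsT n ∎)
    where open ≡.≡-Reasoning

open import Data.Nat using (_+_)

theorem7p4 : (n : ℕ) →
    p (pmSet 47 (3 ∷ 4 ∷ 5 ∷ 6 ∷ 7 ∷ 9 ∷ 15 ∷ 16 ∷ 17 ∷ 18 ∷ 19 ∷ 21 ∷ [])) (n + 3)
    ≡ p (pmSet 47 (1 ∷ 3 ∷ 6 ∷ 9 ∷ 11 ∷ 13 ∷ 15 ∷ 16 ∷ 18 ∷ 20 ∷ 21 ∷ 23 ∷ [])) n
-- 4 + n is the smallest truncation order that still retains the coefficient of index 3 + n.
theorem7p4 n = ≡.trans (≡.cong (p partsS) (ℕ.+-comm n 3)) (p-shifted (4 + n) n ℕ.≤-refl)
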